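{- The localization number of the incidence graph of a Steiner system $S(2,k,v)$ is at most $v/k + O(v^{1-\frac{1}{k-1}}) = (1+o(1))v/k$. The localization number of the incidence graph of a Steiner system $S(t,k,v)$ is at most $v/k + O(v \cdot D^{ -\frac{1}{k-1}}) = (1+o(1))v/k$, where $D = \binom{v-1}{t-1}/\binom{k-1}{t-1}$.
   Context: A Steiner system $S(t,k,v)$ with $2 \le t < k < v$ is a set $X$ of $v$ points with a collection of $k$-element subsets (blocks) such that every $t$-subset of $X$ lies in exactly one block. The number $D = \binom{v-1}{t-1}/\binom{k-1}{t-1}$ is the number of blocks containing any given point. Asymptotic notation refers to $v \to \infty$ with $k$ and $t$ fixed. The incidence graph is the bipartite graph on points and blocks with $x \sim B$ iff $x \in B$. Localization game on a connected graph $G$ with $m$ cops: the robber chooses a starting vertex, invisible to the cops. Each round the cops choose any $m$ vertices (no adjacency restriction) and each learns its distance to the robber; the cops win if after finitely many rounds they determine the robber's vertex uniquely; otherwise the robber moves to a neighbour or stays. The robber knows the cops' strategy. The localization number $\zeta(G)$ is the least $m$ for which $m$ cops can guarantee capture. -}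

module Defs where

open import Data.Nat using (ℕ; zero; suc; _+_; _*_; _∸_; _^_; _≤_; _<_)
open import Data.Nat.Combinatorics using (_C_)
open import Data.Fin using (Fin)
open import Data.Fin.Subset using (Subset; _∈_; _⊆_; ∣_∣)
open import Data.Vec using (Vec; lookup)
open import Data.List using (List; map; upTo)
open import Data.Sum using (_⊎_; inj₁; inj₂)
open import Data.Product using (_×_; ∃; ∃-syntax)
open import Data.Empty using (⊥)
open import Relation.Nullary using (¬_)
open import Relation.Binary.PropositionalEquality using (_≡_)

data Walk {V : Set} (Adj : V → V → Set) : V → V → ℕ → Set where
  here : ∀ {x} → Walk Adj x x 0
  step : ∀ {x y z n} → Adj x y → Walk Adj y z n → Walk Adj x z (suc n)

Dist : {V : Set} (Adj : V → V → Set) → V → V → ℕ → Set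
Dist Adj x y d = Walk Adj x y d × (∀ m → m < d → ¬ Walk Adj x y m)

-- Localization game with m cops.
-- A cop strategy maps the list of responses received so far (one vector
-- of m distances per previous round) to the m vertices probed this round.

Strategy : (V : Set) → ℕ → Set
Strategy V m = List (Vec ℕ m) → Vec V m

prefix : {m : ℕ} → (ℕ → Vec ℕ m) → ℕ → List (Vec ℕ m)
prefix obs i = map obs (upTo i)

RobberWalk : {V : Set} (Adj : V → V → Set) → (ℕ → V) → Set
RobberWalk Adj r = ∀ i → (r (suc i) ≡ r i) ⊎ Adj (r i) (r (suc i))

Consistent : {V : Set} (Adj : V → V → Set) {m : ℕ} →
             Strategy V m → (ℕ → V) → (ℕ → Vec ℕ m) → Set
Consistent Adj σ r obs =
  ∀ i j → Dist Adj (lookup (σ (prefix obs i)) j) (r i) (lookup (obs i) j)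

Located : {V : Set} (Adj : V → V → Set) {m : ℕ} →
          Strategy V m → (ℕ → V) → (ℕ → Vec ℕ m) → ℕ → Set
Located Adj σ r obs N =
  ∀ r' obs' → RobberWalk Adj r' → Consistent Adj σ r' obs' →
  (∀ i → i ≤ N → obs' i ≡ obs i) → r' N ≡ r N

Winning : {V : Set} (Adj : V → V → Set) {m : ℕ} → Strategy V m → Set
Winning Adj σ =
  ∀ r obs → RobberWalk Adj r → Consistent Adj σ r obs →
  ∃[ N ] Located Adj σ r obs N

CopsWin : {V : Set} (Adj : V → V → Set) → ℕ → Set
CopsWin {V} Adj m = ∃ λ (σ : Strategy V m) → Winning Adj σ

-- ζ(G) ≤ M is expressed as: ∃ m ≤ M with CopsWin m; here we need the
-- bound in a general form: ζ(G) satisfies a predicate P (upward closed)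
LocNumSatisfies : {V : Set} (Adj : V → V → Set) → (ℕ → Set) → Set
LocNumSatisfies Adj P = ∃[ m ] (CopsWin Adj m × P m)

IsSteiner : (t k v b : ℕ) → (Fin b → Subset v) → Set
IsSteiner t k v b B =
  2 ≤ t × t < k × k < v ×
  (∀ i → ∣ B i ∣ ≡ k) ×
  (∀ (T : Subset v) → ∣ T ∣ ≡ t →
     ∃[ i ] (T ⊆ B i × (∀ j → T ⊆ B j → j ≡ i)))

IncAdj : {v b : ℕ} → (Fin b → Subset v) → Fin v ⊎ Fin b → Fin v ⊎ Fin b → Set
IncAdj B (inj₁ x) (inj₂ i) = x ∈ B i
IncAdj B (inj₂ i) (inj₁ x) = x ∈ B i
IncAdj B (inj₁ _) (inj₁ _) = ⊥
IncAdj B (inj₂ _) (inj₂ _) = ⊥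

-- Bounds (cleared of real exponents; x = k·m ∸ v is k·(m - v/k)):
-- t = 2:  m ≤ v/k + C v^{1-1/(k-1)}
--   ⇔ (k m ∸ v)^{k-1} ≤ (k C)^{k-1} v^{k-2}
Bound2 : (k c v m : ℕ) → Set
Bound2 k c v m = ((k * m) ∸ v) ^ (k ∸ 1) ≤ (k * c) ^ (k ∸ 1) * v ^ (k ∸ 2)

-- general t, D = (v-1 C t-1)/(k-1 C t-1):  m ≤ v/k + C v D^{-1/(k-1)}
--   ⇔ (k m ∸ v)^{k-1} · (v-1 C t-1) ≤ (k C v)^{k-1} · (k-1 C t-1)
BoundT : (t k c v m : ℕ) → Set
BoundT t k c v m =
  ((k * m) ∸ v) ^ (k ∸ 1) * ((v ∸ 1) C (t ∸ 1))
    ≤ (k * c * v) ^ (k ∸ 1) * ((k ∸ 1) C (t ∸ 1))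

{-# OPTIONS --safe #-}

-- For large v already ⌊v/k⌋ cops win, so no error term is needed and C = 0.
--
-- Fix pairwise disjoint blocks M leaving a set U of about v/2k points uncovered, and
-- probe M together with one point that sweeps over all points. A robber who stays on
-- points cannot move, and the sweep meets him. Once he is on a block L, the answers name
-- the at most k blocks of M that meet L. Every point of L lies in U or in one of these
-- blocks, which is fewer than v/k points; probing all of them in the next round locates
-- the robber, whether he stayed on L or stepped to a point of L.
--
-- M is built greedily. Let d(x) be the number of blocks through x inside U, and let the
-- potential be the sum over U of (d(x) - δ)², where δ is the degree that a random U of the
-- same size would give. Two points share only O(D/v) blocks, so for a block chosen
-- uniformly inside U the potential grows by a factor 1 + O(1/v) and a term O(D²/v) in
-- expectation. It therefore stays O(D²) during all O(v) steps, and as long as U is a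
-- constant fraction of the points there are Ω(vD) blocks inside U to choose from.
module Submission where

-- The size of `U` balances two demands. At most ⌊v/k⌋ - k² points may stay uncovered if all
-- suspects are to be probed in one round, yet the greedy choice is under control only while a
-- constant fraction of the points is uncovered. Hence a matching far from perfect is enough, and
-- the hard last part of a greedy process is avoided.
--
-- In the expected change of the potential the terms of first order in the deviations would
-- dominate. They cancel up to a multiple of (sum of deviations)², because the target `τ` falls by
-- an amount `Δ` with exactly (n - k) Δ = (k² - k) τ; Cauchy-Schwarz bounds what is left by the
-- potential.
--
-- Two estimates lean on each other: slow growth of the potential needs many available blocks, and
-- these are counted through the potential. All constants are therefore fixed beforehand in terms of
-- k, and one induction over the chosen blocks serves both. There are no fractions: deviations are
-- scaled by a common denominator `q`, growth rates by powers of v.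

-- Finite sums of integers and indicators

module IntegerSums where

  open import Data.Bool.Base using (Bool; true; false; not; _∧_)
  open import Data.Fin.Base using (Fin; zero; suc)
  open import Data.Bool.Properties using () renaming (_≟_ to _≟B_)
  open import Data.Fin.Properties using (any?) renaming (_≟_ to _≟F_)
  open import Data.Integer.Base hiding (suc)
  open import Data.Integer.Properties
  open import Data.Integer.Tactic.RingSolver using (solve-∀)
  open import Data.Nat.Base using (zero; suc; z≤n; s≤s)
  open import Data.Product using (∃; _×_; _,_)
  open import Function using (_∘_)
  open import Relation.Nullary using (yes; no; does; contradiction; _×-dec_)
  open import Relation.Binary.PropositionalEquality
  open import Algebra.Properties.Semiring.Sum +-*-semiring using (sum; sum-cong-≗; ∑-distrib-+; ∑-comm; *-distribˡ-sum; *-distribʳ-sum)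

  ≤-by : ∀ {i j} k → 0ℤ ≤ k → i + k ≡ j → i ≤ j
  ≤-by {i} k 0≤k refl = i≤i+j i k {{nonNegative 0≤k}}

  0≤* : ∀ {i j} → 0ℤ ≤ i → 0ℤ ≤ j → 0ℤ ≤ i * j
  0≤* {i} 0≤i 0≤j = ≤-trans (≤-reflexive (sym (*-zeroʳ i))) (*-monoˡ-≤-nonNeg i {{nonNegative 0≤i}} 0≤j)

  0≤+ : ∀ {i j} → 0ℤ ≤ i → 0ℤ ≤ j → 0ℤ ≤ i + j
  0≤+ = +-mono-≤

  0≤+ℕ : ∀ n → 0ℤ ≤ + n
  0≤+ℕ n = +≤+ z≤n

  0≤+* : ∀ n {i} → 0ℤ ≤ i → 0ℤ ≤ + n * i
  0≤+* n 0≤i = 0≤* (0≤+ℕ n) 0≤i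

  0≤i² : ∀ i → 0ℤ ≤ i * i
  0≤i² (+ n)    = 0≤* {+ n} (0≤+ℕ n) (0≤+ℕ n)
  0≤i² -[1+ n ] = +≤+ z≤n

  0≤- : ∀ {i j} → i ≤ j → 0ℤ ≤ j - i
  0≤- = i≤j⇒0≤j-i

  *-monoˡ-≤-0≤ : ∀ {i j} k → 0ℤ ≤ k → i ≤ j → k * i ≤ k * j
  *-monoˡ-≤-0≤ k 0≤k = *-monoˡ-≤-nonNeg k {{nonNegative 0≤k}}

  *-mono-≤-0≤ : ∀ {i j k l} → 0ℤ ≤ i → 0ℤ ≤ l → i ≤ j → k ≤ l → i * k ≤ j * l
  *-mono-≤-0≤ {i} {j} {k} {l} 0≤i 0≤l i≤j k≤l =
    ≤-trans (*-monoˡ-≤-nonNeg i {{nonNegative 0≤i}} k≤l) (*-monoʳ-≤-nonNeg l {{nonNegative 0≤l}} i≤j)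

  Σ-mono : ∀ {n} {f g : Fin n → ℤ} → (∀ i → f i ≤ g i) → sum f ≤ sum g
  Σ-mono {zero}  f≤g = ≤-refl
  Σ-mono {suc n} f≤g = +-mono-≤ (f≤g zero) (Σ-mono (f≤g ∘ suc))

  Σ-0≤ : ∀ {n} {f : Fin n → ℤ} → (∀ i → 0ℤ ≤ f i) → 0ℤ ≤ sum f
  Σ-0≤ {zero}  0≤f = ≤-refl
  Σ-0≤ {suc n} 0≤f = 0≤+ (0≤f zero) (Σ-0≤ (0≤f ∘ suc))

  term≤Σ : ∀ {n} {f : Fin n → ℤ} → (∀ i → 0ℤ ≤ f i) → ∀ i → f i ≤ sum f
  term≤Σ {suc n} {f} 0≤f zero = i≤i+j (f zero) _ {{nonNegative (Σ-0≤ (0≤f ∘ suc))}}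
  term≤Σ {suc n} {f} 0≤f (suc i) =
    ≤-trans (term≤Σ (0≤f ∘ suc) i) (i≤j+i _ (f zero) {{nonNegative (0≤f zero)}})

  Σ-≤0 : ∀ {n} {f : Fin n → ℤ} → (∀ i → f i ≤ 0ℤ) → sum f ≤ 0ℤ
  Σ-≤0 {zero}  f≤0 = ≤-refl
  Σ-≤0 {suc n} f≤0 = +-mono-≤ (f≤0 zero) (Σ-≤0 (f≤0 ∘ suc))

  Σ-cong : ∀ {n} {f g : Fin n → ℤ} → (∀ i → f i ≡ g i) → sum f ≡ sum g
  Σ-cong = sum-cong-≗

  Σ-+ : ∀ {n} (f g : Fin n → ℤ) → sum (λ i → f i + g i) ≡ sum f + sum g
  Σ-+ = ∑-distrib-+

  Σ-*ˡ : ∀ {n} c (f : Fin n → ℤ) → sum (λ i → c * f i) ≡ c * sum f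
  Σ-*ˡ c f = sym (*-distribˡ-sum c f)

  Σ-*ʳ : ∀ {n} c (f : Fin n → ℤ) → sum (λ i → f i * c) ≡ sum f * c
  Σ-*ʳ c f = sym (*-distribʳ-sum c f)

  Σ-neg : ∀ {n} (f : Fin n → ℤ) → sum (λ i → - f i) ≡ - sum f
  Σ-neg {zero}  f = refl
  Σ-neg {suc n} f = trans (cong (_+_ (- f zero)) (Σ-neg (f ∘ suc))) (sym (neg-distrib-+ (f zero) _))

  Σ-minus : ∀ {n} (f g : Fin n → ℤ) → sum (λ i → f i - g i) ≡ sum f - sum g
  Σ-minus f g = trans (Σ-+ f (λ i → - g i)) (cong (_+_ (sum f)) (Σ-neg g))

  Σ-swap : ∀ {m n} (f : Fin m → Fin n → ℤ) → sum (λ i → sum (f i)) ≡ sum (λ j → sum (λ i → f i j))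
  Σ-swap f = ∑-comm f

  Σ-const : ∀ n c → sum {n} (λ _ → c) ≡ + n * c
  Σ-const zero    c = refl
  Σ-const (suc n) c = trans (cong (_+_ c) (Σ-const n c)) (sym (suc-* (+ n) c))

  ι : Bool → ℤ
  ι true  = 1ℤ
  ι false = 0ℤ

  0≤ι : ∀ p → 0ℤ ≤ ι p
  0≤ι true  = +≤+ z≤n
  0≤ι false = +≤+ z≤n

  ι≤1 : ∀ p → ι p ≤ 1ℤ
  ι≤1 true  = +≤+ (s≤s z≤n)
  ι≤1 false = +≤+ z≤n

  ι-∧ : ∀ p r → ι (p ∧ r) ≡ ι p * ι r
  ι-∧ true  true  = refl
  ι-∧ true  false = refl
  ι-∧ false r     = refl

  ι-not : ∀ p → ι (not p) ≡ 1ℤ - ι p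
  ι-not true  = refl
  ι-not false = refl

  ι-idem : ∀ p → ι p * ι p ≡ ι p
  ι-idem true  = refl
  ι-idem false = refl

  Σ-δ : ∀ {n} (f : Fin n → ℤ) (x : Fin n) → sum (λ y → f y * ι (does (x ≟F y))) ≡ f x
  Σ-δ {suc n} f zero = begin
    f zero * 1ℤ + sum (λ y → f (suc y) * 0ℤ) ≡⟨ cong₂ _+_ (*-identityʳ (f zero)) (Σ-*ʳ 0ℤ (f ∘ suc)) ⟩
    f zero + sum (f ∘ suc) * 0ℤ              ≡⟨ cong (_+_ (f zero)) (*-zeroʳ (sum (f ∘ suc))) ⟩
    f zero + 0ℤ                              ≡⟨ +-identityʳ (f zero) ⟩
    f zero                                   ∎
    where open ≡-Reasoning
  Σ-δ {suc n} f (suc x) = trans (cong (_+ sum (λ y → f (suc y) * ι (does (x ≟F y)))) (*-zeroʳ (f zero)))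
    (trans (+-identityˡ _) (Σ-δ (f ∘ suc) x))

  -- Comparing with r after multiplying by the number of candidates avoids a division.
  average : ∀ {n} (a : Fin n → Bool) (f : Fin n → ℤ) r → 0ℤ < sum (λ i → ι (a i)) →
            sum (λ i → ι (a i) * f i) ≤ r → ∃ λ i → a i ≡ true × sum (λ i → ι (a i)) * f i ≤ r
  average {n} a f r 0<N Σ≤r with any? (λ i → (a i ≟B true) ×-dec (sum (λ j → ι (a j)) * f i ≤? r))
  ... | yes p = p
  ... | no ¬p = contradiction contra (<-irrefl refl)
    where
      N = sum (λ i → ι (a i))
      big : ∀ i → ι (a i) * (r + 1ℤ) ≤ ι (a i) * (N * f i)
      big i with a i in eq
      ... | false = ≤-refl
      ... | true  = *-monoˡ-≤-0≤ 1ℤ (+≤+ z≤n)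
          (≤-trans (≤-reflexive (+-comm r 1ℤ)) (i<j⇒suc[i]≤j (≰⇒> (λ Nf≤r → ¬p (i , eq , Nf≤r)))))
      contra : N * r < N * r
      contra = begin-strict
        N * r                               <⟨ *-monoˡ-<-pos N {{positive 0<N}} (i<i+1 r) ⟩
        N * (r + 1ℤ)                        ≡⟨ Σ-*ʳ (r + 1ℤ) (λ i → ι (a i)) ⟨
        sum (λ i → ι (a i) * (r + 1ℤ))      ≤⟨ Σ-mono big ⟩
        sum (λ i → ι (a i) * (N * f i))     ≡⟨ Σ-cong (λ i → lem (ι (a i)) N (f i)) ⟩
        sum (λ i → N * (ι (a i) * f i))     ≡⟨ Σ-*ˡ N (λ i → ι (a i) * f i) ⟩
        N * sum (λ i → ι (a i) * f i)       ≤⟨ *-monoˡ-≤-0≤ N (<⇒≤ 0<N) Σ≤r ⟩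
        N * r                               ∎
        where
        open ≤-Reasoning
        i<i+1 : ∀ r → r < r + 1ℤ
        i<i+1 r = suc[i]≤j⇒i<j (≤-reflexive (+-comm 1ℤ r))
        lem : ∀ x N y → x * (N * y) ≡ N * (x * y)
        lem = solve-∀

-- Regular hypergraphs: loss of degree and the expected change of the potential

module RegularHypergraph where

  open import Data.Bool.Base using (Bool; true; false)
  open import Data.Fin.Base using (Fin; suc)
  open import Data.Integer.Base hiding (suc)
  open import Data.Integer.Properties
  open import Data.Integer.Tactic.RingSolver using (solve-∀)
  open import Data.Nat.Base using (ℕ; suc; z≤n; s≤s)
  open import Relation.Binary.PropositionalEquality
  open import Algebra.Properties.Semiring.Sum +-*-semiring using (sum)
  open IntegerSums

  isPos : ℤ → Bool
  isPos (+ 0) = false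
  isPos _     = true

  isPos-≤ : ∀ {i} → 0ℤ ≤ i → ι (isPos i) ≤ i
  isPos-≤ {+ 0}     _ = ≤-refl
  isPos-≤ {+ suc n} _ = +≤+ (s≤s z≤n)

  isPos-true : ∀ {i} → 1ℤ ≤ i → isPos i ≡ true
  isPos-true {+ suc n} _ = refl
  isPos-true {+ 0} (+≤+ ())

  -- Counting an intersection of size i with multiplicity exceeds counting it once by i - 1. This is
  -- paid for by its i (i - 1) ordered pairs of points, and pairs are controlled by codegrees.
  isPos-≥ : ∀ {i} → 0ℤ ≤ i → i - ι (isPos i) ≤ i * i - i
  isPos-≥ {+ 0}     _ = ≤-refl
  isPos-≥ {+ suc n} _ = ≤-by (+ n * + n) (0≤i² (+ n)) (eq (+ n))
    where
    eq : ∀ n → 1ℤ + n - 1ℤ + n * n ≡ (1ℤ + n) * (1ℤ + n) - (1ℤ + n)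
    eq = solve-∀

  module Regular {v b : ℕ} (inc : Fin v → Fin b → Bool) (k D l : ℤ) where

    I : Fin v → Fin b → ℤ
    I x E = ι (inc x E)

    0≤I : ∀ x E → 0ℤ ≤ I x E
    0≤I x E = 0≤ι (inc x E)

    record IsRegular : Set where
      field
        0≤D    : 0ℤ ≤ D
        0≤l    : 0ℤ ≤ l
        size   : ∀ E → sum (λ y → I y E) ≡ k
        degree : ∀ x → sum (λ E → I x E) ≡ D
        -- distinct points share at most l blocks, in weighted form
        codeg  : ∀ x (f : Fin v → ℤ) → (∀ y → 0ℤ ≤ f y) →
                 sum (λ y → f y * sum (λ E → I x E * I y E)) ≤ l * sum f + D * f x

    meet : Fin b → Fin b → ℤ
    meet E B = sum (λ y → I y E * I y B)

    0≤meet : ∀ E B → 0ℤ ≤ meet E B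
    0≤meet E B = Σ-0≤ (λ y → 0≤* (0≤I y E) (0≤I y B))

    meets : Fin b → Fin b → Bool
    meets E B = isPos (meet E B)

    m : Fin b → Fin b → ℤ
    m E B = ι (meets E B)

    meet-pos : ∀ {x E B} → inc x E ≡ true → inc x B ≡ true → meets E B ≡ true
    meet-pos {x} {E} {B} x∈E x∈B = isPos-true (≤-trans (≤-reflexive (sym one))
        (term≤Σ {f = λ y → I y E * I y B} (λ y → 0≤* (0≤I y E) (0≤I y B)) x))
      where
      one : I x E * I x B ≡ 1ℤ
      one rewrite x∈E | x∈B = refl

    I*I*m : ∀ x E B → I x E * I x B * m E B ≡ I x E * I x B
    I*I*m x E B with inc x E in x∈E | inc x B in x∈B
    ... | false | _     = refl
    ... | true  | false = refl
    ... | true  | true  rewrite meet-pos x∈E x∈B = refl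

    module _ (R : IsRegular) where
      open IsRegular R

      -- The sum counts ordered pairs of distinct points of `E` once for each block containing both.
      -- There are at most k² pairs, each in at most `l` blocks; the term `D` that `codeg` adds for
      -- a point paired with itself is cancelled by the subtracted `meet E B`.
      excess≤ : ∀ E → sum (λ B → meet E B * meet E B - meet E B) ≤ k * (k * l)
      excess≤ E = begin
        sum (λ B → meet E B * meet E B - meet E B)
          ≡⟨ Σ-cong (λ B → expand B) ⟩
        sum (λ B → sum (λ y → I y E * (I y B * meet E B - I y B)))
          ≡⟨ Σ-swap (λ B y → I y E * (I y B * meet E B - I y B)) ⟩
        sum (λ y → sum (λ B → I y E * (I y B * meet E B - I y B)))
          ≡⟨ Σ-cong (λ y → Σ-*ˡ (I y E) (λ B → I y B * meet E B - I y B)) ⟩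
        sum (λ y → I y E * sum (λ B → I y B * meet E B - I y B))
          ≤⟨ Σ-mono point ⟩
        sum (λ y → I y E * (k * l))
          ≡⟨ Σ-*ʳ (k * l) (λ y → I y E) ⟩
        sum (λ y → I y E) * (k * l)
          ≡⟨ cong (_* (k * l)) (size E) ⟩
        k * (k * l) ∎
        where
        open ≤-Reasoning
        alg : ∀ i j c → i * j * c - i * j ≡ i * (j * c - j)
        alg = solve-∀
        expand : ∀ B → meet E B * meet E B - meet E B ≡ sum (λ y → I y E * (I y B * meet E B - I y B))
        expand B = trans (cong (_- meet E B) (sym (Σ-*ʳ (meet E B) (λ y → I y E * I y B))))
          (trans (sym (Σ-minus (λ y → I y E * I y B * meet E B) (λ y → I y E * I y B)))
                 (Σ-cong (λ y → alg (I y E) (I y B) (meet E B))))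
        inner : ∀ y → sum (λ B → I y B * meet E B - I y B) ≡ sum (λ z → I z E * sum (λ B → I y B * I z B)) - D
        inner y = trans (Σ-minus (λ B → I y B * meet E B) (I y)) (cong₂ _-_ swap (degree y))
          where
          alg′ : ∀ p q r → p * (q * r) ≡ q * (p * r)
          alg′ = solve-∀
          swap : sum (λ B → I y B * meet E B) ≡ sum (λ z → I z E * sum (λ B → I y B * I z B))
          swap = trans (Σ-cong (λ B → trans (sym (Σ-*ˡ (I y B) (λ z → I z E * I z B)))
                                            (Σ-cong (λ z → alg′ (I y B) (I z E) (I z B)))))
            (trans (Σ-swap (λ B z → I z E * (I y B * I z B)))
                   (Σ-cong (λ z → Σ-*ˡ (I z E) (λ B → I y B * I z B))))
        point : ∀ y → I y E * sum (λ B → I y B * meet E B - I y B) ≤ I y E * (k * l)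
        point y with inc y E in y∈E
        ... | false = ≤-refl
        ... | true  = *-monoˡ-≤-0≤ 1ℤ (+≤+ z≤n) (begin
            sum (λ B → I y B * meet E B - I y B)             ≡⟨ inner y ⟩
            sum (λ z → I z E * sum (λ B → I y B * I z B)) - D ≤⟨ +-monoˡ-≤ (- D) (codeg y (λ z → I z E) (λ z → 0≤I z E)) ⟩
            l * sum (λ z → I z E) + D * I y E - D            ≡⟨ cong₂ (λ s i → l * s + D * i - D) (size E) (cong ι y∈E) ⟩
            l * k + D * 1ℤ - D                               ≡⟨ alg″ l k D ⟩
            k * l                                            ∎)
          where
          alg″ : ∀ l k D → l * k + D * 1ℤ - D ≡ k * l
          alg″ = solve-∀

      -- u marks the uncovered points, a the blocks still available; the latter lie in u.
      module Live (u : Fin v → Bool) (a : Fin b → Bool)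
                  (live : ∀ x E → I x E * ι (a E) * ι (u x) ≡ I x E * ι (a E)) where

        A : Fin b → ℤ
        A E = ι (a E)
        U : Fin v → ℤ
        U x = ι (u x)

        0≤A : ∀ E → 0ℤ ≤ A E
        0≤A E = 0≤ι (a E)

        0≤IA : ∀ x E → 0ℤ ≤ I x E * A E
        0≤IA x E = 0≤* (0≤I x E) (0≤A E)

        IA≤I : ∀ x E → I x E * A E ≤ I x E
        IA≤I x E = ≤-trans (*-monoˡ-≤-0≤ (I x E) (0≤I x E) (ι≤1 (a E))) (≤-reflexive (*-identityʳ (I x E)))

        N : ℤ
        N = sum A

        d : Fin v → ℤ
        d x = sum (λ E → I x E * A E)

        d≤D : ∀ x → d x ≤ D
        d≤D x = ≤-trans (Σ-mono (IA≤I x)) (≤-reflexive (degree x))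

        dU : ∀ x → d x * U x ≡ d x
        dU x = trans (sym (Σ-*ʳ (U x) (λ E → I x E * A E))) (Σ-cong (live x))

        Σd : sum d ≡ k * N
        Σd = trans (Σ-swap (λ x E → I x E * A E))
          (trans (Σ-cong (λ E → trans (Σ-*ʳ (A E) (λ x → I x E)) (cong (_* A E) (size E)))) (Σ-*ˡ k A))

        h : Fin v → Fin b → ℤ
        h x B = sum (λ E → I x E * A E * m E B)

        0≤h : ∀ x B → 0ℤ ≤ h x B
        0≤h x B = Σ-0≤ (λ E → 0≤* (0≤IA x E) (0≤ι (meets E B)))

        -- A block through `x` that meets `B` joins `x` to one of the k points of `B`, and since `x`
        -- is not among these, each accounts for at most `l` blocks. A single choice thus changes no
        -- surviving degree by much.
        h≤ : ∀ x B → inc x B ≡ false → h x B ≤ k * l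
        h≤ x B x∉B = begin
          h x B                                            ≤⟨ Σ-mono (λ E → *-mono-≤-0≤ (0≤IA x E) (0≤meet E B) (IA≤I x E) (isPos-≤ (0≤meet E B))) ⟩
          sum (λ E → I x E * meet E B)                     ≡⟨ Σ-cong (λ E → trans (sym (Σ-*ˡ (I x E) (λ y → I y E * I y B))) (Σ-cong (λ y → alg (I x E) (I y E) (I y B)))) ⟩
          sum (λ E → sum (λ y → I y B * (I x E * I y E)))  ≡⟨ Σ-swap (λ E y → I y B * (I x E * I y E)) ⟩
          sum (λ y → sum (λ E → I y B * (I x E * I y E)))  ≡⟨ Σ-cong (λ y → Σ-*ˡ (I y B) (λ E → I x E * I y E)) ⟩
          sum (λ y → I y B * sum (λ E → I x E * I y E))    ≤⟨ codeg x (λ y → I y B) (λ y → 0≤I y B) ⟩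
          l * sum (λ y → I y B) + D * I x B                ≡⟨ cong₂ (λ s i → l * s + D * ι i) (size B) x∉B ⟩
          l * k + D * 0ℤ                                   ≡⟨ alg′ l k D ⟩
          k * l                                            ∎
          where
          open ≤-Reasoning
          alg : ∀ p q r → p * (q * r) ≡ r * (p * q)
          alg = solve-∀
          alg′ : ∀ l k D → l * k + D * 0ℤ ≡ k * l
          alg′ = solve-∀

        -- h x B is the loss of degree at x when B is chosen. Summing it over B gives S; Y drops the
        -- condition x ∉ B, and G counts intersections with multiplicity.
        Y G S : Fin v → ℤ
        Y x = sum (λ E → I x E * A E * sum (λ B → A B * m E B))
        G x = sum (λ E → I x E * A E * sum (λ B → A B * meet E B))
        S x = sum (λ B → A B * (1ℤ - I x B) * h x B)

        -- If `B` passes through `x`, it meets every live block through `x`, so `h x B` is all of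
        -- `d x`. The `d x` live blocks of this kind make up the subtracted square.
        S≡ : ∀ x → S x ≡ Y x - d x * d x
        S≡ x = begin
          sum (λ B → A B * (1ℤ - I x B) * h x B)
            ≡⟨ Σ-cong (λ B → alg₁ (A B) (I x B) (h x B)) ⟩
          sum (λ B → A B * h x B - A B * (I x B * h x B))
            ≡⟨ Σ-minus (λ B → A B * h x B) (λ B → A B * (I x B * h x B)) ⟩
          sum (λ B → A B * h x B) - sum (λ B → A B * (I x B * h x B))
            ≡⟨ cong₂ _-_ first second ⟩
          Y x - d x * d x ∎
          where
          open ≡-Reasoning
          alg₁ : ∀ a i h → a * (1ℤ - i) * h ≡ a * h - a * (i * h)
          alg₁ = solve-∀
          alg₂ : ∀ a p m → a * (p * m) ≡ p * (a * m)
          alg₂ = solve-∀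
          alg₃ : ∀ i p a m → i * (p * a * m) ≡ p * i * m * a
          alg₃ = solve-∀
          alg₄ : ∀ p i a → p * i * a ≡ i * (p * a)
          alg₄ = solve-∀
          first : sum (λ B → A B * h x B) ≡ Y x
          first = trans (Σ-cong (λ B → trans (sym (Σ-*ˡ (A B) (λ E → I x E * A E * m E B))) (Σ-cong (λ E → alg₂ (A B) (I x E * A E) (m E B)))))
            (trans (Σ-swap (λ B E → I x E * A E * (A B * m E B))) (Σ-cong (λ E → Σ-*ˡ (I x E * A E) (λ B → A B * m E B))))
          hB : ∀ B → I x B * h x B ≡ I x B * d x
          hB B = trans (sym (Σ-*ˡ (I x B) (λ E → I x E * A E * m E B)))
            (trans (Σ-cong (λ E → trans (alg₃ (I x B) (I x E) (A E) (m E B)) (trans (cong (_* A E) (I*I*m x E B)) (alg₄ (I x E) (I x B) (A E)))))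
                   (Σ-*ˡ (I x B) (λ E → I x E * A E)))
          alg₅ : ∀ a i d → a * (i * d) ≡ i * a * d
          alg₅ = solve-∀
          second : sum (λ B → A B * (I x B * h x B)) ≡ d x * d x
          second = trans (Σ-cong (λ B → trans (cong (A B *_) (hB B)) (alg₅ (A B) (I x B) (d x)))) (Σ-*ʳ (d x) (λ B → I x B * A B))

        G-Y : ∀ x → G x - Y x ≡ sum (λ E → I x E * A E * sum (λ B → A B * (meet E B - m E B)))
        G-Y x = trans (sym (Σ-minus (λ E → I x E * A E * sum (λ B → A B * meet E B)) (λ E → I x E * A E * sum (λ B → A B * m E B))))
          (Σ-cong (λ E → trans (alg (I x E * A E) _ _)
            (cong (I x E * A E *_) (trans (sym (Σ-minus (λ B → A B * meet E B) (λ B → A B * m E B)))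
              (Σ-cong (λ B → alg (A B) (meet E B) (m E B)))))))
          where
          alg : ∀ p q r → p * q - p * r ≡ p * (q - r)
          alg = solve-∀

        0≤G-Y : ∀ x → 0ℤ ≤ G x - Y x
        0≤G-Y x = ≤-trans (Σ-0≤ (λ E → 0≤* (0≤IA x E) (Σ-0≤ (λ B → 0≤* (0≤A B) (0≤- (isPos-≤ (0≤meet E B)))))))
          (≤-reflexive (sym (G-Y x)))

        -- The price of passing from `Y` to `G`. It is worth paying because `G` can be expressed
        -- through the degrees of the points on the blocks at `x`, while `Y` cannot.
        G-Y≤ : ∀ x → G x - Y x ≤ D * (k * (k * l))
        G-Y≤ x = begin
          G x - Y x ≡⟨ G-Y x ⟩
          sum (λ E → I x E * A E * sum (λ B → A B * (meet E B - m E B)))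
            ≤⟨ Σ-mono (λ E → *-mono-≤-0≤ (0≤IA x E) 0≤kkl (IA≤I x E) (inner E)) ⟩
          sum (λ E → I x E * (k * (k * l)))
            ≡⟨ Σ-*ʳ (k * (k * l)) (I x) ⟩
          sum (I x) * (k * (k * l))
            ≡⟨ cong (_* (k * (k * l))) (degree x) ⟩
          D * (k * (k * l)) ∎
          where
          open ≤-Reasoning
          0≤c-m : ∀ E B → 0ℤ ≤ meet E B - m E B
          0≤c-m E B = 0≤- (isPos-≤ (0≤meet E B))
          inner : ∀ E → sum (λ B → A B * (meet E B - m E B)) ≤ k * (k * l)
          inner E = ≤-trans (Σ-mono (λ B → ≤-trans (*-mono-≤-0≤ (0≤A B) (≤-trans (0≤c-m E B) (isPos-≥ (0≤meet E B))) (ι≤1 (a B)) (isPos-≥ (0≤meet E B)))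
            (≤-reflexive (*-identityˡ (meet E B * meet E B - meet E B))))) (excess≤ E)
          0≤kkl : 0ℤ ≤ k * (k * l)
          0≤kkl = ≤-trans (0≤* (0≤i² k) 0≤l) (≤-reflexive (*-assoc k k l))

  -- The target degree is τ / q, and τ decreases by Δ in one step.
  module Potential {v b : ℕ} (inc : Fin v → Fin b → Bool) (k D l : ℤ)
    (R : Regular.IsRegular inc k D l) (u : Fin v → Bool) (a : Fin b → Bool)
    (live : ∀ x E → ι (inc x E) * ι (a E) * ι (u x) ≡ ι (inc x E) * ι (a E)) (q τ Δ : ℤ) where

    open Regular inc k D l public
    open Live R u a live public
    open IsRegular R

    e : Fin v → ℤ
    e x = q * d x - τ

    n s Φ Ψ : ℤ
    n = sum U
    s = sum (λ x → U x * e x)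
    Φ = sum (λ x → U x * (e x * e x))
    Ψ = sum (λ x → U x * (e x * e x * e x))

    -- What `Φ` becomes when `B` is chosen, written entirely in terms of the old state so that it
    -- can be averaged over `B`.
    Φ′ : Fin b → ℤ
    Φ′ B = sum (λ x → U x * (1ℤ - I x B) * ((e x + (Δ - q * h x B)) * (e x + (Δ - q * h x B))))

    W : ℤ
    W = Δ * Δ + q * q * (k * l * (k * l))

    0≤U : ∀ x → 0ℤ ≤ U x
    0≤U x = 0≤ι (u x)

    0≤Φ : 0ℤ ≤ Φ
    0≤Φ = Σ-0≤ (λ x → 0≤* (0≤U x) (0≤i² (e x)))

    Σd≡ΣUd : sum d ≡ sum (λ x → U x * d x)
    Σd≡ΣUd = Σ-cong (λ x → trans (sym (dU x)) (*-comm (d x) (U x)))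

    -- Incidences of live blocks, counted by blocks and by points.
    kqN : k * q * N ≡ n * τ + s
    kqN = begin
      k * q * N                               ≡⟨ alg₁ k q N ⟩
      q * (k * N)                             ≡⟨ cong (q *_) (trans (sym Σd) Σd≡ΣUd) ⟩
      q * sum (λ x → U x * d x)               ≡⟨ Σ-*ˡ q (λ x → U x * d x) ⟨
      sum (λ x → q * (U x * d x))             ≡⟨ Σ-cong (λ x → alg₂ q (U x) (d x) τ) ⟩
      sum (λ x → U x * τ + U x * e x)         ≡⟨ Σ-+ (λ x → U x * τ) (λ x → U x * e x) ⟩
      sum (λ x → U x * τ) + s                 ≡⟨ cong (_+ s) (Σ-*ʳ τ U) ⟩
      n * τ + s                               ∎
      where
      open ≡-Reasoning
      alg₁ : ∀ k q N → k * q * N ≡ q * (k * N)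
      alg₁ = solve-∀
      alg₂ : ∀ q u d τ → q * (u * d) ≡ u * τ + u * (q * d - τ)
      alg₂ = solve-∀

    -- n (n Φ - s²) is the sum of (n e - s)² over the uncovered points.
    cauchy-schwarz : 0ℤ < n → s * s ≤ n * Φ
    cauchy-schwarz 0<n = 0≤i-j⇒j≤i (*-cancelˡ-≤-pos 0ℤ (n * Φ - s * s) n {{positive 0<n}} (begin
      n * 0ℤ                                                     ≡⟨ *-zeroʳ n ⟩
      0ℤ                                                         ≤⟨ Σ-0≤ (λ x → 0≤* (0≤U x) (0≤i² (n * e x - s))) ⟩
      sum (λ x → U x * ((n * e x - s) * (n * e x - s)))          ≡⟨ Σ-cong (λ x → alg₁ (U x) n (e x) s) ⟩
      sum (λ x → n * n * (U x * (e x * e x)) + (- (+ 2 * n * s)) * (U x * e x) + s * s * U x)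
        ≡⟨ trans (Σ-+ (λ x → n * n * (U x * (e x * e x)) + (- (+ 2 * n * s)) * (U x * e x)) (λ x → s * s * U x))
            (cong₂ _+_ (trans (Σ-+ (λ x → n * n * (U x * (e x * e x))) (λ x → (- (+ 2 * n * s)) * (U x * e x)))
              (cong₂ _+_ (Σ-*ˡ (n * n) (λ x → U x * (e x * e x))) (Σ-*ˡ (- (+ 2 * n * s)) (λ x → U x * e x))))
              (Σ-*ˡ (s * s) U)) ⟩
      n * n * Φ + (- (+ 2 * n * s)) * s + s * s * n              ≡⟨ alg₂ n s Φ ⟩
      n * (n * Φ - s * s)                                        ∎))
      where
      open ≤-Reasoning
      alg₁ : ∀ u n e s → u * ((n * e - s) * (n * e - s)) ≡ n * n * (u * (e * e)) + (- (+ 2 * n * s)) * (u * e) + s * s * u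
      alg₁ = solve-∀
      alg₂ : ∀ n s Φ → n * n * Φ + (- (+ 2 * n * s)) * s + s * s * n ≡ n * (n * Φ - s * s)
      alg₂ = solve-∀

    ε : Fin b → ℤ
    ε E = sum (λ x → I x E * e x)

    sumDeg : Fin b → ℤ
    sumDeg E = sum (λ B → A B * meet E B)

    -- Exchanging the sums turns `sumDeg E` into the sum of the live degrees of the points of `E`.
    q*sumDeg : ∀ E → q * sumDeg E ≡ k * τ + ε E
    q*sumDeg E = begin
      q * sumDeg E
        ≡⟨ cong (q *_) (trans (Σ-cong (λ B → sym (Σ-*ˡ (A B) (λ y → I y E * I y B)))) (Σ-swap (λ B y → A B * (I y E * I y B)))) ⟩
      q * sum (λ y → sum (λ B → A B * (I y E * I y B)))
        ≡⟨ cong (q *_) (Σ-cong (λ y → trans (Σ-cong (λ B → alg₁ (A B) (I y E) (I y B))) (Σ-*ˡ (I y E) (λ B → I y B * A B)))) ⟩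
      q * sum (λ y → I y E * d y)
        ≡⟨ Σ-*ˡ q (λ y → I y E * d y) ⟨
      sum (λ y → q * (I y E * d y))
        ≡⟨ Σ-cong (λ y → alg₂ q (I y E) (d y) τ) ⟩
      sum (λ y → I y E * τ + I y E * e y)
        ≡⟨ Σ-+ (λ y → I y E * τ) (λ y → I y E * e y) ⟩
      sum (λ y → I y E * τ) + ε E
        ≡⟨ cong (_+ ε E) (trans (Σ-*ʳ τ (λ y → I y E)) (cong (_* τ) (size E))) ⟩
      k * τ + ε E ∎
      where
      open ≡-Reasoning
      alg₁ : ∀ a i j → a * (i * j) ≡ i * (j * a)
      alg₁ = solve-∀
      alg₂ : ∀ q i d τ → q * (i * d) ≡ i * τ + i * (q * d - τ)
      alg₂ = solve-∀

    ΣeG : sum (λ x → e x * G x) ≡ sum (λ E → A E * sumDeg E * ε E)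
    ΣeG = trans (Σ-cong (λ x → sym (Σ-*ˡ (e x) (λ E → I x E * A E * sumDeg E))))
      (trans (Σ-swap (λ x E → e x * (I x E * A E * sumDeg E)))
        (Σ-cong (λ E → trans (Σ-cong (λ x → alg (e x) (I x E) (A E) (sumDeg E))) (Σ-*ˡ (A E * sumDeg E) (λ x → I x E * e x)))))
      where
      alg : ∀ e i a s → e * (i * a * s) ≡ a * s * (i * e)
      alg = solve-∀

    ΣAε : q * sum (λ E → A E * ε E) ≡ τ * s + Φ
    ΣAε = begin
      q * sum (λ E → A E * ε E)
        ≡⟨ cong (q *_) (trans (Σ-cong (λ E → sym (Σ-*ˡ (A E) (λ x → I x E * e x)))) (Σ-swap (λ E x → A E * (I x E * e x)))) ⟩
      q * sum (λ x → sum (λ E → A E * (I x E * e x)))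
        ≡⟨ cong (q *_) (Σ-cong (λ x → trans (Σ-cong (λ E → alg₁ (A E) (I x E) (e x))) (Σ-*ʳ (e x) (λ E → I x E * A E)))) ⟩
      q * sum (λ x → d x * e x)
        ≡⟨ cong (q *_) (Σ-cong (λ x → cong (_* e x) (sym (dU x)))) ⟩
      q * sum (λ x → d x * U x * e x)
        ≡⟨ Σ-*ˡ q (λ x → d x * U x * e x) ⟨
      sum (λ x → q * (d x * U x * e x))
        ≡⟨ Σ-cong (λ x → alg₂ q (d x) (U x) τ) ⟩
      sum (λ x → τ * (U x * e x) + U x * (e x * e x))
        ≡⟨ trans (Σ-+ (λ x → τ * (U x * e x)) (λ x → U x * (e x * e x))) (cong (_+ Φ) (Σ-*ˡ τ (λ x → U x * e x))) ⟩
      τ * s + Φ ∎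
      where
      open ≡-Reasoning
      alg₁ : ∀ a i e → a * (i * e) ≡ i * a * e
      alg₁ = solve-∀
      alg₂ : ∀ q d u τ → q * (d * u * (q * d - τ)) ≡ τ * (u * (q * d - τ)) + u * ((q * d - τ) * (q * d - τ))
      alg₂ = solve-∀

    -- Points of too large a degree lie on blocks with a large degree sum and lose more blocks.
    -- Since `q * sumDeg E` is k τ + `ε E`, the two sides differ by q times the sum of `ε E` squared
    -- over live blocks, which is dropped.
    correlation : 0ℤ ≤ q → k * τ * (τ * s + Φ) ≤ q * q * sum (λ x → e x * G x)
    correlation 0≤q = begin
      k * τ * (τ * s + Φ)                           ≡⟨ cong (k * τ *_) ΣAε ⟨
      k * τ * (q * sum (λ E → A E * ε E))           ≡⟨ alg₁ k τ q (sum (λ E → A E * ε E)) ⟩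
      q * (k * τ * sum (λ E → A E * ε E))           ≤⟨ *-monoˡ-≤-0≤ q 0≤q (begin
          k * τ * sum (λ E → A E * ε E)             ≡⟨ Σ-*ˡ (k * τ) (λ E → A E * ε E) ⟨
          sum (λ E → k * τ * (A E * ε E))           ≤⟨ Σ-mono (λ E → ≤-by (A E * (ε E * ε E)) (0≤* (0≤A E) (0≤i² (ε E))) (trans (alg₂ (k * τ) (A E) (ε E)) (cong (λ z → A E * z * ε E) (sym (q*sumDeg E))))) ⟩
          sum (λ E → A E * (q * sumDeg E) * ε E)    ≡⟨ trans (Σ-cong (λ E → alg₃ (A E) q (sumDeg E) (ε E))) (Σ-*ˡ q (λ E → A E * sumDeg E * ε E)) ⟩
          q * sum (λ E → A E * sumDeg E * ε E)      ≡⟨ cong (q *_) ΣeG ⟨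
          q * sum (λ x → e x * G x)                 ∎) ⟩
      q * (q * sum (λ x → e x * G x))               ≡⟨ *-assoc q q _ ⟨
      q * q * sum (λ x → e x * G x)                 ∎
      where
      open ≤-Reasoning
      alg₁ : ∀ k τ q z → k * τ * (q * z) ≡ q * (k * τ * z)
      alg₁ = solve-∀
      alg₂ : ∀ c a ε → c * (a * ε) + a * (ε * ε) ≡ a * (c + ε) * ε
      alg₂ = solve-∀
      alg₃ : ∀ a q s ε → a * (q * s) * ε ≡ q * (a * s * ε)
      alg₃ = solve-∀

    module Bounds (2≤k : + 2 ≤ k) (0<q : 0ℤ < q) (0≤τ : 0ℤ ≤ τ) (0≤Δ : 0ℤ ≤ Δ) (τ≤qD : τ ≤ q * D) where

      0≤q : 0ℤ ≤ q
      0≤q = <⇒≤ 0<q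

      0≤k : 0ℤ ≤ k
      0≤k = ≤-trans (+≤+ z≤n) 2≤k

      e≤qD : ∀ x → e x ≤ q * D
      e≤qD x = ≤-trans (i-j≤i (q * d x) τ {{nonNegative 0≤τ}}) (*-monoˡ-≤-0≤ q 0≤q (d≤D x))

      F : Fin v → ℤ
      F x = sum (λ B → A B * (1ℤ - I x B) * ((e x + (Δ - q * h x B)) * (e x + (Δ - q * h x B))))

      ΣAΦ′ : sum (λ B → A B * Φ′ B) ≡ sum (λ x → U x * F x)
      ΣAΦ′ = trans (Σ-cong (λ B → sym (Σ-*ˡ (A B) (λ x → U x * (1ℤ - I x B) * (z x B * z x B)))))
        (trans (Σ-swap (λ B x → A B * (U x * (1ℤ - I x B) * (z x B * z x B))))
          (Σ-cong (λ x → trans (Σ-cong (λ B → alg (A B) (U x) (1ℤ - I x B) (z x B * z x B)))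
            (Σ-*ˡ (U x) (λ B → A B * (1ℤ - I x B) * (z x B * z x B))))))
        where
        z : Fin v → Fin b → ℤ
        z x B = e x + (Δ - q * h x B)
        alg : ∀ a u i z → a * (u * i * z) ≡ u * (a * i * z)
        alg = solve-∀

      -- `Δ` and `q * h x B` are both nonnegative, so the square of their difference is at most the
      -- sum of their squares. The factor `1ℤ - I x B` matters, as `h≤` holds only off `B`.
      square≤W : ∀ x B → A B * (1ℤ - I x B) * ((Δ - q * h x B) * (Δ - q * h x B)) ≤ A B * W
      square≤W x B with inc x B in x∈B
      ... | true  = ≤-trans (≤-reflexive (alg (A B) ((Δ - q * h x B) * (Δ - q * h x B)))) (0≤* (0≤A B) 0≤W)
        where
        alg : ∀ a z → a * (1ℤ - 1ℤ) * z ≡ 0ℤ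
        alg = solve-∀
        0≤W : 0ℤ ≤ W
        0≤W = 0≤+ (0≤i² Δ) (0≤* (0≤i² q) (0≤i² (k * l)))
      ... | false = ≤-trans (≤-reflexive (alg (A B) ((Δ - q * h x B) * (Δ - q * h x B)))) (*-monoˡ-≤-0≤ (A B) (0≤A B) (begin
          (Δ - q * H) * (Δ - q * H)               ≤⟨ ≤-by (+ 2 * (Δ * (q * H))) (0≤+* 2 (0≤* 0≤Δ (0≤* 0≤q (0≤h x B)))) (alg₂ Δ q H) ⟩
          Δ * Δ + q * q * (H * H)                 ≤⟨ +-monoʳ-≤ (Δ * Δ) (*-monoˡ-≤-0≤ (q * q) (0≤i² q) (*-mono-≤-0≤ (0≤h x B) (≤-trans (0≤h x B) H≤) H≤ H≤)) ⟩
          W                                       ∎))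
        where
        open ≤-Reasoning
        H : ℤ
        H = h x B
        H≤ : H ≤ k * l
        H≤ = h≤ x B x∈B
        alg : ∀ a z → a * (1ℤ - 0ℤ) * z ≡ a * z
        alg = solve-∀
        alg₂ : ∀ Δ q H → (Δ - q * H) * (Δ - q * H) + + 2 * (Δ * (q * H)) ≡ Δ * Δ + q * q * (H * H)
        alg₂ = solve-∀

      F≤ : ∀ x → F x ≤ (N - d x) * (e x * e x + + 2 * (e x * Δ)) - + 2 * q * e x * S x + N * W
      F≤ x = begin
        F x
          ≡⟨ Σ-cong (λ B → alg₁ (A B) (I x B) (e x) Δ q (h x B)) ⟩
        sum (λ B → A B * (1ℤ - I x B) * c₁ + (- c₂) * (A B * (1ℤ - I x B) * h x B) + A B * (1ℤ - I x B) * ((Δ - q * h x B) * (Δ - q * h x B)))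
          ≤⟨ Σ-mono (λ B → +-monoʳ-≤ (A B * (1ℤ - I x B) * c₁ + (- c₂) * (A B * (1ℤ - I x B) * h x B)) (square≤W x B)) ⟩
        sum (λ B → A B * (1ℤ - I x B) * c₁ + (- c₂) * (A B * (1ℤ - I x B) * h x B) + A B * W)
          ≡⟨ trans (Σ-+ (λ B → A B * (1ℤ - I x B) * c₁ + (- c₂) * (A B * (1ℤ - I x B) * h x B)) (λ B → A B * W))
              (cong₂ _+_ (trans (Σ-+ (λ B → A B * (1ℤ - I x B) * c₁) (λ B → (- c₂) * (A B * (1ℤ - I x B) * h x B)))
                (cong₂ _+_ (trans (Σ-*ʳ c₁ (λ B → A B * (1ℤ - I x B))) (cong (_* c₁) count)) (Σ-*ˡ (- c₂) (λ B → A B * (1ℤ - I x B) * h x B)))) (Σ-*ʳ W A)) ⟩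
        (N - d x) * c₁ + (- c₂) * S x + N * W
          ≡⟨ cong (λ z → (N - d x) * c₁ + z + N * W) (neg-distribˡ-* c₂ (S x)) ⟨
        (N - d x) * c₁ - c₂ * S x + N * W ∎
        where
        open ≤-Reasoning
        c₁ c₂ : ℤ
        c₁ = e x * e x + + 2 * (e x * Δ)
        c₂ = + 2 * q * e x
        alg₁ : ∀ a i e Δ q h → a * (1ℤ - i) * ((e + (Δ - q * h)) * (e + (Δ - q * h))) ≡
          a * (1ℤ - i) * (e * e + + 2 * (e * Δ)) + (- (+ 2 * q * e)) * (a * (1ℤ - i) * h) + a * (1ℤ - i) * ((Δ - q * h) * (Δ - q * h))
        alg₁ = solve-∀
        alg₂ : ∀ a i → a * (1ℤ - i) ≡ a - i * a
        alg₂ = solve-∀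
        count : sum (λ B → A B * (1ℤ - I x B)) ≡ N - d x
        count = trans (Σ-cong (λ B → alg₂ (A B) (I x B))) (Σ-minus A (λ B → I x B * A B))

      -- Coefficients of the polynomial in `e x` that appears on substituting `e x + τ` for
      -- `q * d x`. The second summand of `c₀` pays for replacing `Y` by `G`.
      c₂ c₁ c₀ : ℤ
      c₂ = q * N + + 3 * τ - + 2 * Δ
      c₁ = + 2 * Δ * (q * N - τ) + + 2 * (τ * τ)
      c₀ = q * N * W + + 2 * (q * q) * (q * D * (D * (k * (k * l))))

      qF≤ : ∀ x → q * F x ≤ e x * e x * e x + c₂ * (e x * e x) + c₁ * e x + c₀ - + 2 * (q * q) * (e x * G x)
      qF≤ x = begin
        q * F x
          ≤⟨ *-monoˡ-≤-0≤ q 0≤q (F≤ x) ⟩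
        q * ((N - d x) * (e x * e x + + 2 * (e x * Δ)) - + 2 * q * e x * S x + N * W)
          ≡⟨ cong (λ z → q * ((N - d x) * (e x * e x + + 2 * (e x * Δ)) - + 2 * q * e x * z + N * W)) (S≡ x) ⟩
        q * ((N - d x) * (e x * e x + + 2 * (e x * Δ)) - + 2 * q * e x * (Y x - d x * d x) + N * W)
          ≤⟨ ≤-by (+ 2 * (q * q) * (M - e x * (G x - Y x))) (0≤* (0≤+* 2 (0≤i² q)) (0≤- eR≤)) (alg q N (d x) τ Δ (Y x) (G x) W M) ⟩
        e x * e x * e x + c₂ * (e x * e x) + c₁ * e x + c₀ - + 2 * (q * q) * (e x * G x) ∎
        where
        open ≤-Reasoning
        M : ℤ
        M = q * D * (D * (k * (k * l)))
        -- `e x` may be very negative; as `G x - Y x` is nonnegative, the upper bound on `e x`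
        -- suffices.
        eR≤ : e x * (G x - Y x) ≤ M
        eR≤ = ≤-trans (*-monoʳ-≤-nonNeg (G x - Y x) {{nonNegative (0≤G-Y x)}} (e≤qD x))
          (*-monoˡ-≤-0≤ (q * D) (0≤* 0≤q 0≤D) (G-Y≤ x))
        alg : ∀ q N d τ Δ Y G W M → let e = q * d - τ in
          q * ((N - d) * (e * e + + 2 * (e * Δ)) - + 2 * q * e * (Y - d * d) + N * W) + + 2 * (q * q) * (M - e * (G - Y))
          ≡ e * e * e + (q * N + + 3 * τ - + 2 * Δ) * (e * e) + (+ 2 * Δ * (q * N - τ) + + 2 * (τ * τ)) * e
            + (q * N * W + + 2 * (q * q) * M) - + 2 * (q * q) * (e * G)
        alg = solve-∀

      U*G : ∀ x → U x * (e x * G x) ≡ e x * G x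
      U*G x = trans (alg (U x) (e x) (G x)) (cong (e x *_) (trans (sym (Σ-*ʳ (U x) (λ E → I x E * A E * sumDeg E)))
        (Σ-cong (λ E → trans (alg′ (I x E * A E) (sumDeg E) (U x)) (cong (_* sumDeg E) (live x E))))))
        where
        alg : ∀ u e g → u * (e * g) ≡ e * (g * u)
        alg = solve-∀
        alg′ : ∀ p s u → p * s * u ≡ p * u * s
        alg′ = solve-∀

      qΣAΦ′≤ : q * sum (λ B → A B * Φ′ B) ≤ Ψ + c₂ * Φ + c₁ * s + c₀ * n - + 2 * (k * τ * (τ * s + Φ))
      qΣAΦ′≤ = begin
        q * sum (λ B → A B * Φ′ B)
          ≡⟨ trans (cong (q *_) ΣAΦ′) (trans (sym (Σ-*ˡ q (λ x → U x * F x))) (Σ-cong (λ x → alg₁ q (U x) (F x)))) ⟩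
        sum (λ x → U x * (q * F x))
          ≤⟨ Σ-mono (λ x → *-monoˡ-≤-0≤ (U x) (0≤U x) (qF≤ x)) ⟩
        sum (λ x → U x * (e x * e x * e x + c₂ * (e x * e x) + c₁ * e x + c₀ - + 2 * (q * q) * (e x * G x)))
          ≡⟨ Σ-cong (λ x → trans (alg₂ (U x) (e x) c₂ c₁ c₀ (+ 2 * (q * q)) (e x * G x)) (cong (λ z → f₃ x + c₂ * f₂ x + c₁ * f₁ x + c₀ * U x + - (+ 2 * (q * q)) * z) (U*G x))) ⟩
        sum (λ x → f₃ x + c₂ * f₂ x + c₁ * f₁ x + c₀ * U x + - (+ 2 * (q * q)) * (e x * G x))
          ≡⟨ trans (Σ-+ (λ x → f₃ x + c₂ * f₂ x + c₁ * f₁ x + c₀ * U x) (λ x → - (+ 2 * (q * q)) * (e x * G x))) (cong₂ _+_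
             (trans (Σ-+ (λ x → f₃ x + c₂ * f₂ x + c₁ * f₁ x) (λ x → c₀ * U x)) (cong₂ _+_
             (trans (Σ-+ (λ x → f₃ x + c₂ * f₂ x) (λ x → c₁ * f₁ x)) (cong₂ _+_
             (trans (Σ-+ f₃ (λ x → c₂ * f₂ x)) (cong (_+_ Ψ) (Σ-*ˡ c₂ f₂))) (Σ-*ˡ c₁ f₁))) (Σ-*ˡ c₀ U)))
             (Σ-*ˡ (- (+ 2 * (q * q))) (λ x → e x * G x))) ⟩
        Ψ + c₂ * Φ + c₁ * s + c₀ * n + - (+ 2 * (q * q)) * sum (λ x → e x * G x)
          ≡⟨ cong (_+_ (Ψ + c₂ * Φ + c₁ * s + c₀ * n)) (alg₃ (q * q) (sum (λ x → e x * G x))) ⟩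
        Ψ + c₂ * Φ + c₁ * s + c₀ * n - + 2 * (q * q * sum (λ x → e x * G x))
          ≤⟨ +-monoʳ-≤ (Ψ + c₂ * Φ + c₁ * s + c₀ * n) (neg-mono-≤ (*-monoˡ-≤-0≤ (+ 2) (+≤+ z≤n) (correlation 0≤q))) ⟩
        Ψ + c₂ * Φ + c₁ * s + c₀ * n - + 2 * (k * τ * (τ * s + Φ)) ∎
        where
        open ≤-Reasoning
        f₁ f₂ f₃ : Fin v → ℤ
        f₁ x = U x * e x
        f₂ x = U x * (e x * e x)
        f₃ x = U x * (e x * e x * e x)
        alg₁ : ∀ q u f → q * (u * f) ≡ u * (q * f)
        alg₁ = solve-∀
        alg₂ : ∀ u e c₂ c₁ c₀ r g → u * (e * e * e + c₂ * (e * e) + c₁ * e + c₀ - r * g) ≡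
          u * (e * e * e) + c₂ * (u * (e * e)) + c₁ * (u * e) + c₀ * u + - r * (u * g)
        alg₂ = solve-∀
        alg₃ : ∀ r g → - (+ 2 * r) * g ≡ - (+ 2 * (r * g))
        alg₃ = solve-∀

      κ : ℤ
      κ = k * k - k

      0≤κ : 0ℤ ≤ κ
      0≤κ = ≤-trans (0≤* {k} {k - 1ℤ} 0≤k (0≤- (≤-trans (+≤+ (s≤s z≤n)) 2≤k))) (≤-reflexive (alg k))
        where
        alg : ∀ k → k * (k - 1ℤ) ≡ k * k - k
        alg = solve-∀

      Ψ≤ : Ψ ≤ q * D * Φ
      Ψ≤ = ≤-trans (Σ-mono (λ x → ≤-by (U x * ((q * D - e x) * (e x * e x))) (0≤* (0≤U x) (0≤* (0≤- (e≤qD x)) (0≤i² (e x)))) (alg (U x) (e x) (q * D))))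
        (≤-reflexive (Σ-*ˡ (q * D) (λ x → U x * (e x * e x))))
        where
        alg : ∀ u e m → u * (e * e * e) + u * ((m - e) * (e * e)) ≡ m * (u * (e * e))
        alg = solve-∀

      expected-potential : (n - k) * Δ ≡ κ * τ → n ≤ + 2 * (n - k) →
        sum (λ B → A B * Φ′ B) ≤ N * Φ + ((+ 4 * κ + 1ℤ) * (D * Φ) + n * (N * W + + 2 * (q * q) * (D * (D * (k * (k * l))))))
      expected-potential nΔ n≤ = *-cancelˡ-≤-pos _ _ q {{positive 0<q}} (≤-trans qΣAΦ′≤
        (≤-by (p₁ + p₂ + p₃ + p₄ + p₅ + p₆) 0≤p final))
        where
        0<n : 0ℤ < n
        0<n = <-≤-trans (+<+ (s≤s z≤n)) (≤-trans 2≤k (≤-by (k + (+ 2 * (n - k) - n)) (0≤+ 0≤k (0≤- n≤)) (alg k n)))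
          where
          alg : ∀ k n → k + (k + (+ 2 * (n - k) - n)) ≡ n
          alg = solve-∀
        X : ℤ
        X = s * (c₁ - + 2 * k * (τ * τ))
        -- Here the choice of `Δ` pays off: after k q N = n τ + s is inserted, (n - k) Δ = κ τ
        -- cancels the linear part and leaves a term quadratic in `s`.
        kX : k * X ≡ + 2 * (Δ * (s * s))
        kX = trans (alg₁ k s Δ (q * N) τ) (trans (cong (λ z → s * (+ 2 * (Δ * (z - k * τ)) - + 2 * (κ * τ) * τ)) (trans (sym (*-assoc k q N)) kqN))
          (trans (cong (λ z → s * (+ 2 * (Δ * (n * τ + s - k * τ)) - + 2 * z * τ)) (sym nΔ)) (alg₂ s Δ n τ k)))
          where
          alg₁ : ∀ k s Δ m τ → k * (s * (+ 2 * Δ * (m - τ) + + 2 * (τ * τ) - + 2 * k * (τ * τ))) ≡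
            s * (+ 2 * (Δ * (k * m - k * τ)) - + 2 * ((k * k - k) * τ) * τ)
          alg₁ = solve-∀
          alg₂ : ∀ s Δ n τ k → s * (+ 2 * (Δ * (n * τ + s - k * τ)) - + 2 * ((n - k) * Δ) * τ) ≡ + 2 * (Δ * (s * s))
          alg₂ = solve-∀
        0≤X : 0ℤ ≤ X
        0≤X = *-cancelˡ-≤-pos 0ℤ X k {{positive (<-≤-trans (+<+ (s≤s z≤n)) 2≤k)}}
          (≤-trans (≤-reflexive (*-zeroʳ k)) (≤-trans (0≤+* 2 (0≤* 0≤Δ (0≤i² s))) (≤-reflexive (sym kX))))
        -- The slacks of the estimates used: `Ψ≤` for the cubic sum, `X` by k X, Cauchy-Schwarz, n Δ
        -- by 2 (n - k) Δ, τ by q D, and finally the negative multiples of `Φ` that are discarded.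
        -- With them the claim is a ring identity.
        p₁ p₂ p₃ p₄ p₅ p₆ : ℤ
        p₁ = q * D * Φ - Ψ
        p₂ = (k - 1ℤ) * X
        p₃ = + 2 * Δ * (n * Φ - s * s)
        p₄ = + 2 * ((+ 2 * (n - k) - n) * (Δ * Φ))
        p₅ = + 4 * κ * ((q * D - τ) * Φ)
        p₆ = (k - + 2 + (k - + 2) + 1ℤ) * (τ * Φ) + + 2 * (Δ * Φ)
        0≤p : 0ℤ ≤ p₁ + p₂ + p₃ + p₄ + p₅ + p₆
        0≤p = 0≤+ (0≤+ (0≤+ (0≤+ (0≤+ (0≤- Ψ≤)
          (0≤* (0≤- (≤-trans (+≤+ (s≤s z≤n)) 2≤k)) 0≤X))
          (0≤* (0≤+* 2 0≤Δ) (0≤- (cauchy-schwarz 0<n))))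
          (0≤+* 2 (0≤* (0≤- n≤) (0≤* 0≤Δ 0≤Φ))))
          (0≤* (0≤+* 4 0≤κ) (0≤* (0≤- τ≤qD) 0≤Φ)))
          (0≤+ (0≤* (0≤+ (0≤+ (0≤- 2≤k) (0≤- 2≤k)) (+≤+ z≤n)) (0≤* 0≤τ 0≤Φ)) (0≤+* 2 (0≤* 0≤Δ 0≤Φ)))
        alg : ∀ Ψ qN τ Δ Φ s k n m κ c₀ → let X = s * (+ 2 * Δ * (qN - τ) + + 2 * (τ * τ) - + 2 * k * (τ * τ)) in
          (Ψ + (qN + + 3 * τ - + 2 * Δ) * Φ + (+ 2 * Δ * (qN - τ) + + 2 * (τ * τ)) * s + c₀ * n - + 2 * (k * τ * (τ * s + Φ)))
          + ((m * Φ - Ψ) + (+ 2 * (Δ * (s * s)) - X) + + 2 * Δ * (n * Φ - s * s) + + 2 * ((+ 2 * (κ * τ) - n * Δ) * Φ) + + 4 * κ * ((m - τ) * Φ)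
            + ((k - + 2 + (k - + 2) + 1ℤ) * (τ * Φ) + + 2 * (Δ * Φ)))
          ≡ qN * Φ + (+ 4 * κ + 1ℤ) * (m * Φ) + n * c₀
        alg = solve-∀
        p₂≡ : p₂ ≡ + 2 * (Δ * (s * s)) - X
        p₂≡ = trans (alg₁ k X) (cong (_- X) kX)
          where
          alg₁ : ∀ k X → (k - 1ℤ) * X ≡ k * X - X
          alg₁ = solve-∀
        p₄≡ : p₄ ≡ + 2 * ((+ 2 * (κ * τ) - n * Δ) * Φ)
        p₄≡ = trans (alg₁ n k Δ Φ) (cong (λ z → + 2 * ((+ 2 * z - n * Δ) * Φ)) nΔ)
          where
          alg₁ : ∀ n k Δ Φ → + 2 * ((+ 2 * (n - k) - n) * (Δ * Φ)) ≡ + 2 * ((+ 2 * ((n - k) * Δ) - n * Δ) * Φ)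
          alg₁ = solve-∀
        final : (Ψ + c₂ * Φ + c₁ * s + c₀ * n - + 2 * (k * τ * (τ * s + Φ))) + (p₁ + p₂ + p₃ + p₄ + p₅ + p₆)
          ≡ q * (N * Φ + ((+ 4 * κ + 1ℤ) * (D * Φ) + n * (N * W + + 2 * (q * q) * (D * (D * (k * (k * l)))))))
        final = trans (cong₂ (λ y z → (Ψ + c₂ * Φ + c₁ * s + c₀ * n - + 2 * (k * τ * (τ * s + Φ))) + (p₁ + y + p₃ + z + p₅ + p₆)) p₂≡ p₄≡)
          (trans (alg Ψ (q * N) τ Δ Φ s k n (q * D) κ c₀)
            (alg₁ q N Φ κ D n W (D * (k * (k * l)))))
          where
          alg₁ : ∀ q N Φ κ D n W r → q * N * Φ + (+ 4 * κ + 1ℤ) * (q * D * Φ) + n * (q * N * W + + 2 * (q * q) * (q * D * r))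
            ≡ q * (N * Φ + ((+ 4 * κ + 1ℤ) * (D * Φ) + n * (N * W + + 2 * (q * q) * (D * r))))
          alg₁ = solve-∀

-- Integer substitutes for exponential bounds, and the target degrees

module Growth where

  open import Data.Nat.Base
  open import Data.Nat.Properties
  open import Data.Nat.DivMod using (m/n*n≤m; m≡m%n+[m/n]*n; m%n<n; m≥n⇒m/n>0)
  open import Data.Nat.Tactic.RingSolver using (solve-∀)
  open import Relation.Binary.PropositionalEquality

  *-^-distrib : ∀ n a b → (a * b) ^ n ≡ a ^ n * b ^ n
  *-^-distrib zero    a b = refl
  *-^-distrib (suc n) a b = trans (cong (a * b *_) (*-^-distrib n a b)) (alg a b (a ^ n) (b ^ n))
    where
    alg : ∀ a b c d → a * b * (c * d) ≡ a * c * (b * d)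
    alg = solve-∀

  -- With x = K / v this is (1 + x)^j (1 - j x) ≤ 1, by induction from (1 + x) (1 - (j + 1) x) ≤ 1 -
  -- j x. Truncated subtraction makes the step trivial once the second factor reaches zero.
  bernoulli : ∀ v K j → (v + K) ^ j * (v ∸ j * K) ≤ v ^ j * v
  bernoulli v K zero    = ≤-refl
  bernoulli v K (suc j) = begin
    (v + K) * (v + K) ^ j * (v ∸ (K + j * K))     ≡⟨ cong ((v + K) * (v + K) ^ j *_) shift ⟩
    (v + K) * (v + K) ^ j * (r ∸ K)               ≡⟨ alg (v + K) ((v + K) ^ j) (r ∸ K) ⟩
    (v + K) ^ j * ((v + K) * (r ∸ K))             ≤⟨ *-monoʳ-≤ ((v + K) ^ j) (small (≤-total r K)) ⟩
    (v + K) ^ j * (v * r)                         ≡⟨ alg′ ((v + K) ^ j) v r ⟩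
    v * ((v + K) ^ j * r)                         ≤⟨ *-monoʳ-≤ v (bernoulli v K j) ⟩
    v * (v ^ j * v)                               ≡⟨ *-assoc v (v ^ j) v ⟨
    v * v ^ j * v                                 ∎
    where
    open ≤-Reasoning
    open import Data.Sum using (_⊎_; inj₁; inj₂)
    r : ℕ
    r = v ∸ j * K
    shift : v ∸ (K + j * K) ≡ r ∸ K
    shift = trans (cong (v ∸_) (+-comm K (j * K))) (sym (∸-+-assoc v (j * K) K))
    alg : ∀ a p r → a * p * r ≡ p * (a * r)
    alg = solve-∀
    alg′ : ∀ p v r → p * (v * r) ≡ v * (p * r)
    alg′ = solve-∀
    small : r ≤ K ⊎ K ≤ r → (v + K) * (r ∸ K) ≤ v * r
    small (inj₁ r≤K) = ≤-trans (≤-reflexive (trans (cong ((v + K) *_) (m≤n⇒m∸n≡0 r≤K)) (*-zeroʳ (v + K)))) z≤n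
    small (inj₂ K≤r) = begin
      (v + K) * c         ≡⟨ *-distribʳ-+ c v K ⟩
      v * c + K * c       ≤⟨ +-monoʳ-≤ (v * c) (*-monoʳ-≤ K (≤-trans (m∸n≤m r K) (m∸n≤m v (j * K)))) ⟩
      v * c + K * v       ≡⟨ alg″ v c K ⟩
      v * (c + K)         ≡⟨ cong (v *_) (m∸n+n≡m K≤r) ⟩
      v * r               ∎
      where
      c : ℕ
      c = r ∸ K
      alg″ : ∀ v c K → v * c + K * v ≡ v * (c + K)
      alg″ = solve-∀

  short-growth : ∀ v K j .{{_ : NonZero v}} → 2 * (j * K) ≤ v → (v + K) ^ j ≤ 2 * v ^ j
  short-growth v K j 2jK≤v = *-cancelʳ-≤ ((v + K) ^ j) (2 * v ^ j) v (begin
    (v + K) ^ j * v                     ≤⟨ *-monoʳ-≤ ((v + K) ^ j) half ⟩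
    (v + K) ^ j * (2 * (v ∸ j * K))     ≡⟨ alg ((v + K) ^ j) (v ∸ j * K) ⟩
    2 * ((v + K) ^ j * (v ∸ j * K))     ≤⟨ *-monoʳ-≤ 2 (bernoulli v K j) ⟩
    2 * (v ^ j * v)                     ≡⟨ *-assoc 2 (v ^ j) v ⟨
    2 * v ^ j * v                       ∎)
    where
    open ≤-Reasoning
    alg : ∀ p r → p * (2 * r) ≡ 2 * (p * r)
    alg = solve-∀
    half : v ≤ 2 * (v ∸ j * K)
    half = begin
      v                                  ≡⟨ m+n∸n≡m v v ⟨
      v + v ∸ v                          ≤⟨ ∸-monoʳ-≤ (v + v) 2jK≤v ⟩
      v + v ∸ 2 * (j * K)                ≡⟨ cong (λ z → v + z ∸ 2 * (j * K)) (+-identityʳ v) ⟨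
      2 * v ∸ 2 * (j * K)                ≡⟨ *-distribˡ-∸ 2 v (j * K) ⟨
      2 * (v ∸ j * K)                    ∎

  -- A bound on (1 + K / v)^i that does not depend on v: 4 K stretches of `h` = ⌊v / 2K⌋ steps cover
  -- all i ≤ v steps, and each stretch at most doubles. The exponent `r` pads i to whole stretches
  -- and is cancelled at the end.
  growth : ∀ K v i .{{_ : NonZero K}} → 2 * K ≤ v → i ≤ v → (v + K) ^ i ≤ 2 ^ (4 * K) * v ^ i
  growth K@(suc _) v i 2K≤v i≤v = *-cancelʳ-≤ ((v + K) ^ i) (2 ^ (4 * K) * v ^ i) (v ^ r) {{m^n≢0 v r}} (begin
    (v + K) ^ i * v ^ r                   ≤⟨ *-monoʳ-≤ ((v + K) ^ i) (^-monoˡ-≤ r (m≤m+n v K)) ⟩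
    (v + K) ^ i * (v + K) ^ r             ≡⟨ ^-distribˡ-+-* (v + K) i r ⟨
    (v + K) ^ (i + r)                     ≡⟨ cong ((v + K) ^_) (m+[n∸m]≡n i≤) ⟩
    (v + K) ^ (h * (4 * K))               ≡⟨ ^-*-assoc (v + K) h (4 * K) ⟨
    ((v + K) ^ h) ^ (4 * K)               ≤⟨ ^-monoˡ-≤ (4 * K) (short-growth v K h 2hK≤v) ⟩
    (2 * v ^ h) ^ (4 * K)                 ≡⟨ *-^-distrib (4 * K) 2 (v ^ h) ⟩
    2 ^ (4 * K) * (v ^ h) ^ (4 * K)       ≡⟨ cong (2 ^ (4 * K) *_) (^-*-assoc v h (4 * K)) ⟩
    2 ^ (4 * K) * v ^ (h * (4 * K))       ≡⟨ cong (λ z → 2 ^ (4 * K) * v ^ z) (m+[n∸m]≡n i≤) ⟨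
    2 ^ (4 * K) * v ^ (i + r)             ≡⟨ cong (2 ^ (4 * K) *_) (^-distribˡ-+-* v i r) ⟩
    2 ^ (4 * K) * (v ^ i * v ^ r)         ≡⟨ *-assoc (2 ^ (4 * K)) (v ^ i) (v ^ r) ⟨
    2 ^ (4 * K) * v ^ i * v ^ r           ∎)
    where
    open ≤-Reasoning
    instance
      v≢0 : NonZero v
      v≢0 = >-nonZero (≤-trans (s≤s z≤n) 2K≤v)
    h : ℕ
    h = v / (2 * K)
    2hK≤v : 2 * (h * K) ≤ v
    2hK≤v = ≤-trans (≤-reflexive (alg h K)) (m/n*n≤m v (2 * K))
      where
      alg : ∀ h K → 2 * (h * K) ≡ h * (2 * K)
      alg = solve-∀
    1≤h : 1 ≤ h
    1≤h = m≥n⇒m/n>0 2K≤v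
    i≤ : i ≤ h * (4 * K)
    i≤ = begin
      i                                   ≤⟨ i≤v ⟩
      v                                   ≡⟨ m≡m%n+[m/n]*n v (2 * K) ⟩
      v % (2 * K) + h * (2 * K)           ≤⟨ +-monoˡ-≤ (h * (2 * K)) (≤-trans (<⇒≤ (m%n<n v (2 * K))) (≤-trans (≤-reflexive (sym (*-identityˡ (2 * K)))) (*-monoˡ-≤ (2 * K) 1≤h))) ⟩
      h * (2 * K) + h * (2 * K)           ≡⟨ alg h K ⟩
      h * (4 * K)                         ∎
      where
      alg : ∀ h K → h * (2 * K) + h * (2 * K) ≡ h * (4 * K)
      alg = solve-∀
    r : ℕ
    r = h * (4 * K) ∸ i

  -- With k² + w points left, rising k (k - 1) w is proportional to the degree to be expected,
  -- and rising-shift makes its decrease in one step of size k exact.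
  rising : ℕ → ℕ → ℕ → ℕ
  rising k zero    w = 1
  rising k (suc j) w = rising k j w * (w + k * suc j)

  rising-shift : ∀ k j w → rising k j (w + k) * (w + k) ≡ rising k j w * (w + k * suc j)
  rising-shift k zero    w = cong (λ z → 1 * (w + z)) (sym (*-identityʳ k))
  rising-shift k (suc j) w = begin
    rising k j (w + k) * (w + k + k * suc j) * (w + k)           ≡⟨ alg (rising k j (w + k)) (w + k) k j ⟩
    rising k j (w + k) * (w + k) * (w + k + k * suc j)           ≡⟨ cong₂ _*_ (rising-shift k j w) (alg′ w k j) ⟩
    rising k j w * (w + k * suc j) * (w + k * suc (suc j))       ∎
    where
    open ≡-Reasoning
    alg : ∀ p x k j → p * (x + k * (1 + j)) * x ≡ p * x * (x + k * (1 + j))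
    alg = solve-∀
    alg′ : ∀ w k j → w + k + k * (1 + j) ≡ w + k * (1 + (1 + j))
    alg′ = solve-∀

  rising-mono : ∀ k j {w z} → w ≤ z → rising k j w ≤ rising k j z
  rising-mono k zero    w≤z = ≤-refl
  rising-mono k (suc j) w≤z = *-mono-≤ (rising-mono k j w≤z) (+-monoˡ-≤ (k * suc j) w≤z)

  rising-pos : ∀ k j w .{{_ : NonZero k}} → 0 < rising k j w
  rising-pos k zero    w = s≤s z≤n
  rising-pos k@(suc k′) (suc j) w = *-mono-≤ (rising-pos k j w) (≤-trans (s≤s z≤n) (m≤n+m (k * suc j) w))

  -- This keeps the target degree at a constant fraction of `D` as long as a constant fraction of
  -- the points is uncovered.
  rising-ratio : ∀ k j c w z → z + k * j ≤ c * w → rising k j z ≤ c ^ j * rising k j w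
  rising-ratio k zero    c w z _ = ≤-refl
  rising-ratio k (suc j) c w z z≤ = begin
    rising k j z * (z + k * suc j)                  ≤⟨ *-mono-≤ (rising-ratio k j c w z (≤-trans (+-monoʳ-≤ z (*-monoʳ-≤ k (n≤1+n j))) z≤)) (≤-trans z≤ (*-monoʳ-≤ c (m≤m+n w (k * suc j)))) ⟩
    c ^ j * rising k j w * (c * (w + k * suc j))    ≡⟨ alg (c ^ j) (rising k j w) c (w + k * suc j) ⟩
    c * c ^ j * (rising k j w * (w + k * suc j))    ∎
    where
    open ≤-Reasoning
    alg : ∀ p r c y → p * r * (c * y) ≡ c * p * (r * y)
    alg = solve-∀

-- The greedy choice of disjoint blocks

module GreedyMatching where

  open import Data.Bool.Base using (Bool; true; not; _∧_)
  open import Data.Fin.Base using (Fin; zero; suc)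
  open import Data.Integer.Base hiding (suc; _^_)
  open import Data.Integer.Properties
  open import Data.Integer.Tactic.RingSolver using (solve-∀)
  import Data.Nat.Base as ℕ
  import Data.Nat.Properties as ℕ
  import Data.Nat.Tactic.RingSolver as ℕRing
  open import Data.Nat.Base using (ℕ; zero; suc; z≤n; s≤s)
  open import Data.Product using (∃; _×_; proj₁; proj₂)
  open import Data.Sum using (_⊎_; inj₁; inj₂)
  open import Data.Vec.Base using (Vec; []; _∷_; lookup)
  open import Relation.Nullary using (contradiction)
  open import Relation.Binary.PropositionalEquality
  open import Algebra.Properties.Semiring.Sum +-*-semiring using (sum)
  open IntegerSums
  open RegularHypergraph
  open Growth

  -- The expected bound divided by `N`, with the orders of magnitude inserted: N is at least v D /
  -- Γ, l at most k D / v, and Δ at most 2 k³ q D / v. Each of `t₁` to `t₆` is the slack of one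
  -- estimate, up to a nonnegative factor.
  potential-growth : ∀ {N Φ Φ′ n v D l k q Δ κ Γ} → 0ℤ < N → 0ℤ ≤ Φ → 0ℤ ≤ n → 0ℤ ≤ v → 0ℤ ≤ D → 0ℤ ≤ l → 0ℤ ≤ k → 0ℤ ≤ Δ →
    κ ≤ k * k → n ≤ v → l * v ≤ k * D → v * D ≤ Γ * N → v * Δ ≤ + 2 * (k * (k * k)) * (q * D) →
    N * Φ′ ≤ N * Φ + ((+ 4 * κ + 1ℤ) * (D * Φ) + n * (N * (Δ * Δ + q * q * (k * l * (k * l))) + + 2 * (q * q) * (D * (D * (k * (k * l)))))) →
    v * Φ′ ≤ (v + (+ 4 * (k * k) + 1ℤ) * Γ) * Φ +
      (+ 4 * (k * k * k * (k * k * k)) + k * k * (k * k) + + 2 * (k * k * k) * Γ) * (q * D * (q * D))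
  potential-growth {N} {Φ} {Φ′} {n} {v} {D} {l} {k} {q} {Δ} {κ} {Γ} 0<N 0≤Φ 0≤n 0≤v 0≤D 0≤l 0≤k 0≤Δ κ≤kk n≤v lv≤kD vD≤ΓN vΔ≤ step =
    *-cancelˡ-≤-pos _ _ N {{positive 0<N}} (≤-by (v * t₁ + t₂ + t₃ + N * t₄ + N * t₅ + t₆)
      (0≤+ (0≤+ (0≤+ (0≤+ (0≤+ (0≤* 0≤v (0≤- step))
        (0≤* (0≤* (0≤+* 4 (0≤- κ≤kk)) 0≤v) (0≤* 0≤D 0≤Φ)))
        (0≤* (0≤* (0≤+ (0≤+* 4 (0≤i² k)) (0≤+ℕ 1)) 0≤Φ) (0≤- vD≤ΓN)))
        (0≤* 0≤N (0≤- Δ-part)))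
        (0≤* 0≤N (0≤* (0≤i² q) (0≤* (0≤i² k) (0≤- l-part)))))
        (0≤* (0≤+* 2 (0≤* (0≤i² (q * D)) (0≤i² k))) (0≤- n-part)))
      (alg N Φ Φ′ n v D l k q Δ κ Γ))
    where
    0≤N : 0ℤ ≤ N
    0≤N = <⇒≤ 0<N
    0≤kD : 0ℤ ≤ k * D
    0≤kD = 0≤* 0≤k 0≤D
    V : ℤ
    V = + 2 * (k * (k * k)) * (q * D)
    Δ-part : v * n * (Δ * Δ) ≤ V * V
    Δ-part = ≤-trans (*-monoʳ-≤-nonNeg (Δ * Δ) {{nonNegative (0≤i² Δ)}} (*-monoˡ-≤-0≤ v 0≤v n≤v))
      (≤-trans (≤-reflexive (alg′ v Δ)) (*-mono-≤-0≤ (0≤* 0≤v 0≤Δ) (≤-trans (0≤* 0≤v 0≤Δ) vΔ≤) vΔ≤ vΔ≤))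
      where
      alg′ : ∀ v Δ → v * v * (Δ * Δ) ≡ v * Δ * (v * Δ)
      alg′ = solve-∀
    l-part : v * n * (l * l) ≤ k * D * (k * D)
    l-part = ≤-trans (*-monoʳ-≤-nonNeg (l * l) {{nonNegative (0≤i² l)}} (*-monoˡ-≤-0≤ v 0≤v n≤v))
      (≤-trans (≤-reflexive (alg′ v l)) (*-mono-≤-0≤ (0≤* 0≤l 0≤v) 0≤kD lv≤kD lv≤kD))
      where
      alg′ : ∀ v l → v * v * (l * l) ≡ l * v * (l * v)
      alg′ = solve-∀
    n-part : n * (l * v) ≤ k * (Γ * N)
    n-part = ≤-trans (*-mono-≤-0≤ 0≤n 0≤kD n≤v lv≤kD) (≤-trans (≤-reflexive (alg′ v k D)) (*-monoˡ-≤-0≤ k 0≤k vD≤ΓN))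
      where
      alg′ : ∀ v k D → v * (k * D) ≡ k * (v * D)
      alg′ = solve-∀
    t₁ t₂ t₃ t₄ t₅ t₆ : ℤ
    t₁ = N * Φ + ((+ 4 * κ + 1ℤ) * (D * Φ) + n * (N * (Δ * Δ + q * q * (k * l * (k * l))) + + 2 * (q * q) * (D * (D * (k * (k * l)))))) - N * Φ′
    t₂ = + 4 * (k * k - κ) * v * (D * Φ)
    t₃ = (+ 4 * (k * k) + 1ℤ) * Φ * (Γ * N - v * D)
    t₄ = V * V - v * n * (Δ * Δ)
    t₅ = q * q * (k * k * (k * D * (k * D) - v * n * (l * l)))
    t₆ = + 2 * (q * D * (q * D) * (k * k)) * (k * (Γ * N) - n * (l * v))
    alg : ∀ N Φ Φ′ n v D l k q Δ κ Γ → let V = + 2 * (k * (k * k)) * (q * D) in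
      N * (v * Φ′) +
      (v * (N * Φ + ((+ 4 * κ + 1ℤ) * (D * Φ) + n * (N * (Δ * Δ + q * q * (k * l * (k * l))) + + 2 * (q * q) * (D * (D * (k * (k * l)))))) - N * Φ′)
      + + 4 * (k * k - κ) * v * (D * Φ)
      + (+ 4 * (k * k) + 1ℤ) * Φ * (Γ * N - v * D)
      + N * (V * V - v * n * (Δ * Δ))
      + N * (q * q * (k * k * (k * D * (k * D) - v * n * (l * l))))
      + + 2 * (q * D * (q * D) * (k * k)) * (k * (Γ * N) - n * (l * v)))
      ≡ N * ((v + (+ 4 * (k * k) + 1ℤ) * Γ) * Φ +
        (+ 4 * (k * k * k * (k * k * k)) + k * k * (k * k) + + 2 * (k * k * k) * Γ) * (q * D * (q * D)))
    alg = solve-∀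

  -- A bounded potential keeps the mean live degree above half of its target, as long as `n` exceeds
  -- a constant. This returns the lower bound on `N` that `potential-growth` consumes.
  many-blocks : ∀ {N Φ n s v D k q τ T K} → 0ℤ < q → 0ℤ < τ → 0ℤ ≤ n → 0ℤ ≤ k → 0ℤ ≤ T → 0ℤ ≤ K → 0ℤ ≤ q * D →
    k * q * N ≡ n * τ + s → s * s ≤ n * Φ → Φ ≤ K * (q * D * (q * D)) → q * D ≤ T * τ → + 4 * (K * (T * T)) < n →
    v ≤ + 2 * k * n → v * D ≤ + 4 * (k * k) * T * N
  many-blocks {N} {Φ} {n} {s} {v} {D} {k} {q} {τ} {T} {K} 0<q 0<τ 0≤n 0≤k 0≤T 0≤K 0≤qD kqN ss≤ Φ≤ qD≤ n-large v≤ =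
    *-cancelˡ-≤-pos _ _ q {{positive 0<q}} (begin
      q * (v * D)                       ≡⟨ alg₁ q v D ⟩
      v * (q * D)                       ≤⟨ *-monoʳ-≤-nonNeg (q * D) {{nonNegative 0≤qD}} v≤ ⟩
      + 2 * k * n * (q * D)             ≤⟨ *-monoˡ-≤-0≤ (+ 2 * k * n) (0≤* (0≤+* 2 0≤k) 0≤n) qD≤ ⟩
      + 2 * k * n * (T * τ)             ≡⟨ alg₂ k n T τ ⟩
      + 2 * k * T * (n * τ)             ≤⟨ *-monoˡ-≤-0≤ (+ 2 * k * T) (0≤* (0≤+* 2 0≤k) 0≤T) (nτ≤ (≤-total (n * τ) (+ 2 * (n * τ + s)))) ⟩
      + 2 * k * T * (+ 2 * (n * τ + s)) ≡⟨ cong (λ z → + 2 * k * T * (+ 2 * z)) kqN ⟨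
      + 2 * k * T * (+ 2 * (k * q * N)) ≡⟨ alg₃ k T q N ⟩
      q * (+ 4 * (k * k) * T * N)       ∎)
    where
    open ≤-Reasoning
    alg₁ : ∀ q v D → q * (v * D) ≡ v * (q * D)
    alg₁ = solve-∀
    alg₂ : ∀ k n T τ → + 2 * k * n * (T * τ) ≡ + 2 * k * T * (n * τ)
    alg₂ = solve-∀
    alg₃ : ∀ k T q N → + 2 * k * T * (+ 2 * (k * q * N)) ≡ q * (+ 4 * (k * k) * T * N)
    alg₃ = solve-∀
    0≤τ : 0ℤ ≤ τ
    0≤τ = <⇒≤ 0<τ
    0<n : 0ℤ < n
    0<n = ≤-<-trans (0≤+* 4 (0≤* 0≤K (0≤i² T))) n-large
    c : ℤ
    c = + 4 * (K * (T * T))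
    nτ≤ : n * τ ≤ + 2 * (n * τ + s) ⊎ + 2 * (n * τ + s) ≤ n * τ → n * τ ≤ + 2 * (n * τ + s)
    nτ≤ (inj₁ p) = p
    -- If nτ + s ≤ nτ/2 then (nτ)² ≤ 4s² ≤ 4nΦ, so that n would be bounded.
    nτ≤ (inj₂ p) = contradiction n≤c (<⇒≱ n-large)
      where
      g : ℤ
      g = n * τ - + 2 * (n * τ + s)
      0≤g : 0ℤ ≤ g
      0≤g = 0≤- p
      alg₄ : ∀ n τ s → let g = n * τ - + 2 * (n * τ + s) in n * (τ * τ) * n + (+ 2 * (n * τ * g) + g * g) ≡ + 4 * (s * s)
      alg₄ = solve-∀
      alg₅ : ∀ n K T τ → + 4 * (n * (K * (T * τ * (T * τ)))) ≡ n * (τ * τ) * (+ 4 * (K * (T * T)))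
      alg₅ = solve-∀
      chain : n * (τ * τ) * n ≤ n * (τ * τ) * c
      chain = begin
        n * (τ * τ) * n                            ≤⟨ ≤-by (+ 2 * (n * τ * g) + g * g) (0≤+ (0≤+* 2 (0≤* (0≤* 0≤n 0≤τ) 0≤g)) (0≤i² g)) (alg₄ n τ s) ⟩
        + 4 * (s * s)                              ≤⟨ *-monoˡ-≤-0≤ (+ 4) (0≤+ℕ 4) ss≤ ⟩
        + 4 * (n * Φ)                              ≤⟨ *-monoˡ-≤-0≤ (+ 4) (0≤+ℕ 4) (*-monoˡ-≤-0≤ n 0≤n (≤-trans Φ≤ (*-monoˡ-≤-0≤ K 0≤K (*-mono-≤-0≤ 0≤qD (≤-trans 0≤qD qD≤) qD≤ qD≤)))) ⟩
        + 4 * (n * (K * (T * τ * (T * τ))))        ≡⟨ alg₅ n K T τ ⟩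
        n * (τ * τ) * c                            ∎
      0<nττ : 0ℤ < n * (τ * τ)
      0<nττ = subst (_< n * (τ * τ)) (trans (cong (n *_) (*-zeroʳ τ)) (*-zeroʳ n))
        (*-monoˡ-<-pos n {{positive 0<n}} (*-monoˡ-<-pos τ {{positive 0<τ}} 0<τ))
      n≤c : n ≤ c
      n≤c = *-cancelˡ-≤-pos n c (n * (τ * τ)) {{positive 0<nττ}} chain

  module Constants (k : ℕ) where
    -- `T` bounds the ratio of the first target degree to any later one, and `Γ` is the constant
    -- that `many-blocks` then yields. In one step the potential grows by the factor 1 + `K₁` / v
    -- and by `K₂` Q² / v, hence stays below `K₃` Q² for v steps. The summands of `v₀` serve the
    -- growth bound, the passage from `active` to v ≤ 4 k w, and the size of `n` needed in
    -- `many-blocks`.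
    T Γ K₁ K₂ K₃ v₀ : ℕ
    T  = (4 ℕ.* k) ℕ.^ (k ℕ.∸ 1)
    Γ  = 4 ℕ.* (k ℕ.* k) ℕ.* T
    K₁ = (4 ℕ.* (k ℕ.* k) ℕ.+ 1) ℕ.* Γ
    K₂ = 4 ℕ.* (k ℕ.* k ℕ.* k ℕ.* (k ℕ.* k ℕ.* k)) ℕ.+ k ℕ.* k ℕ.* (k ℕ.* k) ℕ.+ 2 ℕ.* (k ℕ.* k ℕ.* k) ℕ.* Γ
    K₃ = K₂ ℕ.* 2 ℕ.^ (4 ℕ.* K₁)
    v₀ = 2 ℕ.* K₁ ℕ.+ 4 ℕ.* (k ℕ.* k ℕ.* k) ℕ.+ suc (2 ℕ.* k ℕ.* (4 ℕ.* (K₃ ℕ.* (T ℕ.* T))))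

  module Process (j : ℕ) (1≤j : 1 ℕ.≤ j) {v b : ℕ} (inc : Fin v → Fin b → Bool) (D l : ℕ) (1≤D : 1 ℕ.≤ D)
    (R : Regular.IsRegular inc (+ suc j) (+ D) (+ l)) (lv≤kD : l ℕ.* v ℕ.≤ suc j ℕ.* D)
    (w₀ : ℕ) (v≡ : v ≡ suc j ℕ.* suc j ℕ.+ w₀) where

    k : ℕ
    k = suc j

    open Constants k
    open Regular inc (+ k) (+ D) (+ l) using (I; m; meets; I*I*m)

    -- With n = k² + w points uncovered, `P w` is the product of n - k, n - 2k, ..., n - (k - 1) k,
    -- which behaves like the power n^(k - 1). The offset k² keeps all factors natural numbers. The
    -- target degree is D `P w` / `P w₀`.
    P : ℕ → ℕ
    P = rising k j

    q : ℕ
    q = P w₀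

    Q : ℤ
    Q = + q * + D

    Live : (Fin v → Bool) → (Fin b → Bool) → Set
    Live u a = ∀ x E → ι (inc x E) * ι (a E) * ι (u x) ≡ ι (inc x E) * ι (a E)

    potential : ∀ u a → Live u a → ℕ → ℤ
    potential u a live w = Potential.Φ inc (+ k) (+ D) (+ l) R u a live (+ q) (+ (D ℕ.* P w)) 0ℤ

    -- `cover` says at once that the chosen blocks are disjoint and that `u` marks exactly the
    -- points outside them. `bound` reads Φ ≤ (i K₂ / v) (1 + K₁ / v)^i Q² with denominators
    -- cleared, the solution of the recurrence in `potential-growth`.
    record State (i w : ℕ) : Set where
      field
        blocks : Vec (Fin b) i
        u      : Fin v → Bool
        a      : Fin b → Bool
        live   : Live u a
        count  : sum (λ x → ι (u x)) ≡ + (k ℕ.* k ℕ.+ w)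
        cover  : ∀ x → ι (u x) + sum (λ t → ι (inc x (lookup blocks t))) ≡ 1ℤ
        bound  : + (v ℕ.^ i ℕ.* v) * potential u a live w ≤ + (i ℕ.* K₂ ℕ.* (v ℕ.+ K₁) ℕ.^ i) * (Q * Q)

    initial : State 0 w₀
    initial = record
      { blocks = []
      ; u      = λ _ → true
      ; a      = λ _ → true
      ; live   = live₀
      ; count  = trans (Σ-const v 1ℤ) (trans (*-identityʳ (+ v)) (cong +_ v≡))
      ; cover  = λ _ → refl
      -- All points have degree `D`, which is the target at `w₀`; every deviation is zero.
      ; bound  = ≤-reflexive (trans (cong (+ (1 ℕ.* v) *_) flat) (*-zeroʳ (+ (1 ℕ.* v))))
      }
      where
      live₀ : Live (λ _ → true) (λ _ → true)
      live₀ x E = *-identityʳ _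
      module Pot = Potential inc (+ k) (+ D) (+ l) R (λ _ → true) (λ _ → true) live₀ (+ q) (+ (D ℕ.* q)) 0ℤ
      e≡0 : ∀ x → Pot.e x ≡ 0ℤ
      e≡0 x = trans (cong₂ (λ y z → + q * y - z)
          (trans (Σ-cong (λ E → *-identityʳ (I x E))) (Regular.IsRegular.degree R x)) (pos-* D q))
        (alg (+ q) (+ D))
        where
        alg : ∀ q D → q * D - D * q ≡ 0ℤ
        alg = solve-∀
      flat : Pot.Φ ≡ 0ℤ
      flat = trans (Σ-cong (λ x → cong (λ z → 1ℤ * (z * z)) (e≡0 x))) (trans (Σ-const v 0ℤ) (*-zeroʳ (+ v)))

    module Step (v₀≤v : v₀ ℕ.≤ v) {i w : ℕ} (v-split : v ≡ k ℕ.* k ℕ.+ k ℕ.* suc i ℕ.+ w)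
      (active : v ℕ.≤ 2 ℕ.* k ℕ.* (k ℕ.* k ℕ.+ w)) (st : State i (w ℕ.+ k)) where

      open State st

      τ τ′ Δ : ℤ
      τ  = + (D ℕ.* P (w ℕ.+ k))
      τ′ = + (D ℕ.* P w)
      Δ  = τ - τ′

      open Potential inc (+ k) (+ D) (+ l) R u a live (+ q) τ Δ
        hiding (I; m; meets; I*I*m)

      0<k : 0 ℕ.< k
      0<k = s≤s z≤n

      kk+w+k≤v : k ℕ.* k ℕ.+ (w ℕ.+ k) ℕ.≤ v
      kk+w+k≤v = subst (k ℕ.* k ℕ.+ (w ℕ.+ k) ℕ.≤_) (sym v-split)
        (ℕ.≤-trans (ℕ.m≤m+n _ (k ℕ.* i)) (ℕ.≤-reflexive (alg (k ℕ.* k) w k i)))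
        where
        alg : ∀ c w k i → c ℕ.+ (w ℕ.+ k) ℕ.+ k ℕ.* i ≡ c ℕ.+ k ℕ.* (1 ℕ.+ i) ℕ.+ w
        alg = ℕRing.solve-∀

      w+k≤w₀ : w ℕ.+ k ℕ.≤ w₀
      w+k≤w₀ = ℕ.+-cancelˡ-≤ (k ℕ.* k) _ _ (subst (k ℕ.* k ℕ.+ (w ℕ.+ k) ℕ.≤_) v≡ kk+w+k≤v)

      i≤v : i ℕ.≤ v
      i≤v = begin
        i                            ≤⟨ ℕ.m≤n*m i k ⟩
        k ℕ.* i                      ≤⟨ ℕ.*-monoʳ-≤ k (ℕ.n≤1+n i) ⟩
        k ℕ.* suc i                  ≤⟨ ℕ.m≤n+m _ (k ℕ.* k) ⟩
        k ℕ.* k ℕ.+ k ℕ.* suc i      ≤⟨ ℕ.m≤m+n _ w ⟩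
        k ℕ.* k ℕ.+ k ℕ.* suc i ℕ.+ w ≡⟨ v-split ⟨
        v                            ∎
        where open ℕ.≤-Reasoning

      -- Doubling `active` gives 2 v ≤ 4 k³ + 4 k w, and `v₀` is large enough for 4 k³ to cancel
      -- against one v.
      v≤4kw : v ℕ.≤ 4 ℕ.* k ℕ.* w
      v≤4kw = ℕ.+-cancelˡ-≤ v _ _ (begin
        v ℕ.+ v                                             ≤⟨ ℕ.+-mono-≤ active active ⟩
        2 ℕ.* k ℕ.* (k ℕ.* k ℕ.+ w) ℕ.+ 2 ℕ.* k ℕ.* (k ℕ.* k ℕ.+ w)  ≡⟨ alg k w ⟩
        4 ℕ.* (k ℕ.* k ℕ.* k) ℕ.+ 4 ℕ.* k ℕ.* w             ≤⟨ ℕ.+-monoˡ-≤ (4 ℕ.* k ℕ.* w) (ℕ.≤-trans (ℕ.m≤n+m _ (2 ℕ.* K₁)) (ℕ.≤-trans (ℕ.m≤m+n _ _) v₀≤v)) ⟩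
        v ℕ.+ 4 ℕ.* k ℕ.* w                                 ∎)
        where
        open ℕ.≤-Reasoning
        alg : ∀ k w → 2 ℕ.* k ℕ.* (k ℕ.* k ℕ.+ w) ℕ.+ 2 ℕ.* k ℕ.* (k ℕ.* k ℕ.+ w) ≡ 4 ℕ.* (k ℕ.* k ℕ.* k) ℕ.+ 4 ℕ.* k ℕ.* w
        alg = ℕRing.solve-∀

      2K₁≤v : 2 ℕ.* K₁ ℕ.≤ v
      2K₁≤v = ℕ.≤-trans (ℕ.m≤m+n _ _) (ℕ.≤-trans (ℕ.m≤m+n _ _) v₀≤v)

      q≤TP : q ℕ.≤ T ℕ.* P (w ℕ.+ k)
      q≤TP = rising-ratio k j (4 ℕ.* k) (w ℕ.+ k) w₀ (begin
        w₀ ℕ.+ k ℕ.* j                ≤⟨ ℕ.+-monoʳ-≤ w₀ (ℕ.*-monoʳ-≤ k (ℕ.n≤1+n j)) ⟩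
        w₀ ℕ.+ k ℕ.* k                ≡⟨ trans (ℕ.+-comm w₀ (k ℕ.* k)) (sym v≡) ⟩
        v                             ≤⟨ v≤4kw ⟩
        4 ℕ.* k ℕ.* w                 ≤⟨ ℕ.*-monoʳ-≤ (4 ℕ.* k) (ℕ.m≤m+n w k) ⟩
        4 ℕ.* k ℕ.* (w ℕ.+ k)         ∎)
        where open ℕ.≤-Reasoning

      n≡ : n ≡ + (k ℕ.* k ℕ.+ (w ℕ.+ k))
      n≡ = count

      n-k≡ : n - + k ≡ + k * + k + + w
      n-k≡ = trans (cong (_- + k) n≡) (trans (cong (λ z → z + (+ w + + k) - + k) (pos-* k k)) (alg (+ k) (+ w)))
        where
        alg : ∀ k w → k * k + (w + k) - k ≡ k * k + w
        alg = solve-∀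

      0<q : 0ℤ < + q
      0<q = +<+ (rising-pos k j w₀)

      0<τ : 0ℤ < τ
      0<τ = +<+ (ℕ.*-mono-≤ 1≤D (rising-pos k j (w ℕ.+ k)))

      0≤Δ : 0ℤ ≤ Δ
      0≤Δ = 0≤- (+≤+ (ℕ.*-monoʳ-≤ D (rising-mono k j (ℕ.m≤m+n w k))))

      τ≤Q : τ ≤ Q
      τ≤Q = ≤-trans (+≤+ (ℕ.≤-trans (ℕ.*-monoʳ-≤ D (rising-mono k j w+k≤w₀)) (ℕ.≤-reflexive (ℕ.*-comm D q))))
        (≤-reflexive (pos-* q D))

      0≤Q : 0ℤ ≤ Q
      0≤Q = 0≤* (0≤+ℕ q) (0≤+ℕ D)

      Q≤Tτ : Q ≤ + T * τ
      Q≤Tτ = ≤-trans (≤-reflexive (sym (pos-* q D))) (≤-trans (+≤+ (begin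
        q ℕ.* D                        ≤⟨ ℕ.*-monoˡ-≤ D q≤TP ⟩
        T ℕ.* P (w ℕ.+ k) ℕ.* D        ≡⟨ alg T (P (w ℕ.+ k)) D ⟩
        T ℕ.* (D ℕ.* P (w ℕ.+ k))      ∎)) (≤-reflexive (pos-* T _)))
        where
        open ℕ.≤-Reasoning
        alg : ∀ T p D → T ℕ.* p ℕ.* D ≡ T ℕ.* (D ℕ.* p)
        alg = ℕRing.solve-∀

      open Bounds (+≤+ (s≤s 1≤j)) 0<q (<⇒≤ 0<τ) 0≤Δ τ≤Q using (κ; 0≤κ; expected-potential)

      κ≤kk : κ ≤ + k * + k
      κ≤kk = i-j≤i (+ k * + k) (+ k)

      -- By `rising-shift`, (n - k) `P w` equals (w + k) `P (w + k)`. Subtracting this from (n - k)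
      -- `P (w + k)` leaves exactly k² - k times `P (w + k)`.
      nΔ≡ : (n - + k) * Δ ≡ κ * τ
      nΔ≡ = begin
        (n - + k) * Δ
          ≡⟨ cong₂ _*_ n-k≡ (cong₂ _-_ (pos-* D (P (w ℕ.+ k))) (pos-* D (P w))) ⟩
        (+ k * + k + + w) * (+ D * + P (w ℕ.+ k) - + D * + P w)
          ≡⟨ alg₁ (+ k) (+ w) (+ D) (+ P (w ℕ.+ k)) (+ P w) ⟩
        + D * ((+ k * + k + + w) * + P (w ℕ.+ k) - + P w * (+ w + + k * + k))
          ≡⟨ cong (λ z → + D * ((+ k * + k + + w) * + P (w ℕ.+ k) - z)) shift ⟨
        + D * ((+ k * + k + + w) * + P (w ℕ.+ k) - + P (w ℕ.+ k) * (+ w + + k))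
          ≡⟨ alg₂ (+ k) (+ w) (+ D) (+ P (w ℕ.+ k)) ⟩
        κ * (+ D * + P (w ℕ.+ k))
          ≡⟨ cong (κ *_) (pos-* D (P (w ℕ.+ k))) ⟨
        κ * τ ∎
        where
        open ≡-Reasoning
        shift : + P (w ℕ.+ k) * (+ w + + k) ≡ + P w * (+ w + + k * + k)
        shift = trans (sym (pos-* (P (w ℕ.+ k)) (w ℕ.+ k))) (trans (cong +_ (rising-shift k j w))
          (trans (pos-* (P w) (w ℕ.+ k ℕ.* k)) (cong (λ z → + P w * (+ w + z)) (pos-* k k))))
        alg₁ : ∀ k w D p p′ → (k * k + w) * (D * p - D * p′) ≡ D * ((k * k + w) * p - p′ * (w + k * k))
        alg₁ = solve-∀
        alg₂ : ∀ k w D p → D * ((k * k + w) * p - p * (w + k)) ≡ (k * k - k) * (D * p)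
        alg₂ = solve-∀

      n≤2[n-k] : n ≤ + 2 * (n - + k)
      n≤2[n-k] = begin
        n                                   ≡⟨ n≡ ⟩
        + (k ℕ.* k ℕ.+ (w ℕ.+ k))           ≤⟨ +≤+ (halving k w 0<k) ⟩
        + (2 ℕ.* (k ℕ.* k ℕ.+ w))           ≡⟨ trans (pos-* 2 (k ℕ.* k ℕ.+ w)) (cong (λ z → + 2 * (z + + w)) (pos-* k k)) ⟩
        + 2 * (+ k * + k + + w)             ≡⟨ cong (+ 2 *_) n-k≡ ⟨
        + 2 * (n - + k)                     ∎
        where
        open ≤-Reasoning
        halving : ∀ k w → 0 ℕ.< k → k ℕ.* k ℕ.+ (w ℕ.+ k) ℕ.≤ 2 ℕ.* (k ℕ.* k ℕ.+ w)
        halving k w 0<k = ℕ.≤-trans (ℕ.+-monoʳ-≤ (k ℕ.* k) (ℕ.+-mono-≤ (ℕ.m≤m+n w w) (ℕ.m≤m*n k k {{ℕ.>-nonZero 0<k}})))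
          (ℕ.≤-reflexive (alg k w))
          where
          alg : ∀ k w → k ℕ.* k ℕ.+ (w ℕ.+ w ℕ.+ k ℕ.* k) ≡ 2 ℕ.* (k ℕ.* k ℕ.+ w)
          alg = ℕRing.solve-∀

      v≤2k[n-k] : + v ≤ + 2 * + k * (n - + k)
      v≤2k[n-k] = ≤-trans (+≤+ active) (≤-reflexive (trans (pos-* (2 ℕ.* k) (k ℕ.* k ℕ.+ w))
        (cong₂ _*_ (pos-* 2 k) (trans (cong (_+ + w) (pos-* k k)) (sym n-k≡)))))

      vΔ≤ : + v * Δ ≤ + 2 * (+ k * (+ k * + k)) * Q
      vΔ≤ = begin
        + v * Δ                                     ≤⟨ *-monoʳ-≤-nonNeg Δ {{nonNegative 0≤Δ}} v≤2k[n-k] ⟩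
        + 2 * + k * (n - + k) * Δ                   ≡⟨ trans (*-assoc (+ 2 * + k) (n - + k) Δ) (cong (+ 2 * + k *_) nΔ≡) ⟩
        + 2 * + k * (κ * τ)                         ≤⟨ *-monoˡ-≤-0≤ (+ 2 * + k) (0≤+* 2 (0≤+ℕ k))
                                                        (*-mono-≤-0≤ 0≤κ 0≤Q κ≤kk τ≤Q) ⟩
        + 2 * + k * (+ k * + k * Q)                 ≡⟨ alg (+ k) Q ⟩
        + 2 * (+ k * (+ k * + k)) * Q               ∎
        where
        open ≤-Reasoning
        alg : ∀ k Q → + 2 * k * (k * k * Q) ≡ + 2 * (k * (k * k)) * Q
        alg = solve-∀

      1≤v : 1 ℕ.≤ v
      1≤v = ℕ.≤-trans (s≤s z≤n) (ℕ.≤-trans (ℕ.m≤n+m _ (2 ℕ.* K₁ ℕ.+ 4 ℕ.* (k ℕ.* k ℕ.* k))) v₀≤v)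

      instance
        K₁≢0 : ℕ.NonZero K₁
        K₁≢0 = ℕ.m*n≢0 (4 ℕ.* (k ℕ.* k) ℕ.+ 1) Γ {{ℕ.>-nonZero (ℕ.m≤n+m 1 (4 ℕ.* (k ℕ.* k)))}} {{ℕ.m*n≢0 (4 ℕ.* (k ℕ.* k)) T {{_}} {{ℕ.m^n≢0 (4 ℕ.* k) (k ℕ.∸ 1)}}}}

      -- At most v steps are made, so i / v is at most 1 and `growth` caps the power in `bound`.
      Φ≤ : Φ ≤ + K₃ * (Q * Q)
      Φ≤ = *-cancelˡ-≤-pos _ _ (+ V) {{positive 0<V}} (begin
        + V * Φ                                              ≤⟨ bound ⟩
        + (i ℕ.* K₂ ℕ.* (v ℕ.+ K₁) ℕ.^ i) * (Q * Q)          ≤⟨ *-monoʳ-≤-nonNeg (Q * Q) {{nonNegative (0≤i² Q)}} (+≤+ coeff) ⟩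
        + (V ℕ.* K₃) * (Q * Q)                               ≡⟨ trans (cong (_* (Q * Q)) (pos-* V K₃)) (*-assoc (+ V) (+ K₃) (Q * Q)) ⟩
        + V * (+ K₃ * (Q * Q))                               ∎)
        where
        V : ℕ
        V = v ℕ.^ i ℕ.* v
        0<V : 0ℤ < + V
        0<V = +<+ (ℕ.*-mono-≤ (ℕ.m^n>0 v {{ℕ.>-nonZero 1≤v}} i) 1≤v)
        coeff : i ℕ.* K₂ ℕ.* (v ℕ.+ K₁) ℕ.^ i ℕ.≤ V ℕ.* K₃
        coeff = begin
          i ℕ.* K₂ ℕ.* (v ℕ.+ K₁) ℕ.^ i                       ≤⟨ ℕ.*-mono-≤ (ℕ.*-monoˡ-≤ K₂ i≤v) (growth K₁ v i 2K₁≤v i≤v) ⟩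
          v ℕ.* K₂ ℕ.* (2 ℕ.^ (4 ℕ.* K₁) ℕ.* v ℕ.^ i)         ≡⟨ alg v K₂ (2 ℕ.^ (4 ℕ.* K₁)) (v ℕ.^ i) ⟩
          V ℕ.* K₃                                            ∎
          where
          open ℕ.≤-Reasoning
          alg : ∀ v a c d → v ℕ.* a ℕ.* (c ℕ.* d) ≡ d ℕ.* v ℕ.* (a ℕ.* c)
          alg = ℕRing.solve-∀
        open ≤-Reasoning

      n-large : + 4 * (+ K₃ * (+ T * + T)) < n
      n-large = begin-strict
        + 4 * (+ K₃ * (+ T * + T))            ≡⟨ trans (pos-* 4 (K₃ ℕ.* (T ℕ.* T))) (cong (+ 4 *_) (trans (pos-* K₃ (T ℕ.* T)) (cong (+ K₃ *_) (pos-* T T)))) ⟨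
        + (4 ℕ.* (K₃ ℕ.* (T ℕ.* T)))          <⟨ +<+ small ⟩
        + (k ℕ.* k ℕ.+ (w ℕ.+ k))             ≡⟨ n≡ ⟨
        n                                     ∎
        where
        c : ℕ
        c = 4 ℕ.* (K₃ ℕ.* (T ℕ.* T))
        small : c ℕ.< k ℕ.* k ℕ.+ (w ℕ.+ k)
        -- The last summand of `v₀` gives 2 k c < v, and `active` turns this into a bound on the
        -- number of uncovered points.
        small = ℕ.<-≤-trans (ℕ.*-cancelˡ-< (2 ℕ.* k) c (k ℕ.* k ℕ.+ w)
          (ℕ.≤-trans (ℕ.m≤n+m _ (2 ℕ.* K₁ ℕ.+ 4 ℕ.* (k ℕ.* k ℕ.* k))) (ℕ.≤-trans v₀≤v active)))
          (ℕ.+-monoʳ-≤ (k ℕ.* k) (ℕ.m≤m+n w k))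
        open ≤-Reasoning

      vD≤ΓN : + v * + D ≤ + Γ * N
      vD≤ΓN = ≤-trans (many-blocks {N} {Φ} {n} {s} {+ v} {+ D} {+ k} {+ q} {τ} {+ T} {+ K₃} 0<q 0<τ (≤-trans (0≤+ℕ _) (≤-reflexive (sym n≡))) (0≤+ℕ k) (0≤+ℕ T) (0≤+ℕ K₃) 0≤Q
          kqN (cauchy-schwarz (≤-<-trans (0≤+* 4 (0≤* {+ K₃} (0≤+ℕ K₃) (0≤i² (+ T)))) n-large)) Φ≤ Q≤Tτ n-large
          (≤-trans v≤2k[n-k] (*-monoˡ-≤-0≤ (+ 2 * + k) (0≤+* 2 (0≤+ℕ k)) (i-j≤i n (+ k)))))
        (≤-reflexive (cong (_* N) (sym (trans (pos-* (4 ℕ.* (k ℕ.* k)) T) (cong (_* + T) (trans (pos-* 4 (k ℕ.* k)) (cong (+ 4 *_) (pos-* k k))))))))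

      0<N : 0ℤ < N
      0<N = *-cancelˡ-<-nonNeg (+ Γ) (<-≤-trans (≤-<-trans (≤-reflexive (*-zeroʳ (+ Γ))) (<-≤-trans (+<+ (ℕ.*-mono-≤ 1≤v 1≤D)) (≤-reflexive (pos-* v D)))) vD≤ΓN)

      -- The random choice made deterministic: some live block does no worse than the average over
      -- all of them.
      chosen : ∃ λ B → a B ≡ true × N * Φ′ B ≤ N * Φ + ((+ 4 * κ + 1ℤ) * (+ D * Φ) + n * (N * W + + 2 * (+ q * + q) * (+ D * (+ D * (+ k * (+ k * + l))))))
      chosen = average a Φ′ _ 0<N (expected-potential nΔ≡ n≤2[n-k])

      B : Fin b
      B = proj₁ chosen

      aB : ι (a B) ≡ 1ℤ
      aB = cong ι (proj₁ (proj₂ chosen))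

      IU : ∀ x → I x B * ι (u x) ≡ I x B
      IU x = trans (cong (_* ι (u x)) (sym IA)) (trans (live x B) IA)
        where
        IA : I x B * ι (a B) ≡ I x B
        IA = trans (cong (I x B *_) aB) (*-identityʳ (I x B))

      u′ : Fin v → Bool
      u′ x = u x ∧ not (inc x B)

      -- `B` has points and so meets itself; it is retired along with the blocks that it spoils.
      a′ : Fin b → Bool
      a′ E = a E ∧ not (meets E B)

      u′≡ : ∀ x → ι (u′ x) ≡ ι (u x) * (1ℤ - I x B)
      u′≡ x = trans (ι-∧ (u x) (not (inc x B))) (cong (ι (u x) *_) (ι-not (inc x B)))

      a′≡ : ∀ E → ι (a′ E) ≡ ι (a E) * (1ℤ - m E B)
      a′≡ E = trans (ι-∧ (a E) (not (meets E B))) (cong (ι (a E) *_) (ι-not (meets E B)))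

      live′ : Live u′ a′
      live′ x E = begin
        I x E * ι (a′ E) * ι (u′ x)
          ≡⟨ cong₂ (λ y z → I x E * y * z) (a′≡ E) (u′≡ x) ⟩
        I x E * (A E * (1ℤ - m E B)) * (U x * (1ℤ - I x B))
          ≡⟨ alg₁ (I x E) (A E) (m E B) (U x) (I x B) ⟩
        I x E * A E * U x * (1ℤ - m E B) - A E * U x * (I x E * I x B - I x E * I x B * m E B)
          ≡⟨ cong₂ (λ y z → y * (1ℤ - m E B) - A E * U x * (I x E * I x B - z)) (live x E) (I*I*m x E B) ⟩
        I x E * A E * (1ℤ - m E B) - A E * U x * (I x E * I x B - I x E * I x B)
          ≡⟨ alg₂ (I x E) (A E) (m E B) (U x) (I x B) ⟩
        I x E * (A E * (1ℤ - m E B))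
          ≡⟨ cong (I x E *_) (a′≡ E) ⟨
        I x E * ι (a′ E) ∎
        where
        open ≡-Reasoning
        alg₁ : ∀ i a m u c → i * (a * (1ℤ - m)) * (u * (1ℤ - c)) ≡ i * a * u * (1ℤ - m) - a * u * (i * c - i * c * m)
        alg₁ = solve-∀
        alg₂ : ∀ i a m u c → i * a * (1ℤ - m) - a * u * (i * c - i * c) ≡ i * (a * (1ℤ - m))
        alg₂ = solve-∀

      count′ : sum (λ x → ι (u′ x)) ≡ + (k ℕ.* k ℕ.+ w)
      count′ = begin
        sum (λ x → ι (u′ x))                ≡⟨ Σ-cong (λ x → trans (u′≡ x) (trans (alg (U x) (I x B)) (cong (λ z → U x - z) (IU x)))) ⟩
        sum (λ x → U x - I x B)             ≡⟨ Σ-minus U (λ x → I x B) ⟩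
        n - sum (λ x → I x B)               ≡⟨ cong (λ z → n - z) (Regular.IsRegular.size R B) ⟩
        n - + k                             ≡⟨ n-k≡ ⟩
        + k * + k + + w                     ≡⟨ cong (_+ + w) (pos-* k k) ⟨
        + (k ℕ.* k ℕ.+ w)                   ∎
        where
        open ≡-Reasoning
        alg : ∀ u i → u * (1ℤ - i) ≡ u - i * u
        alg = solve-∀

      cover′ : ∀ x → ι (u′ x) + sum (λ t → ι (inc x (lookup (B ∷ blocks) t))) ≡ 1ℤ
      cover′ x = trans (cong (_+ (I x B + c)) (u′≡ x)) (trans (alg (U x) (I x B) c)
        (trans (cong (λ z → U x + c + (I x B - z)) (IU x)) (cong₂ _+_ (cover x) (+-inverseʳ (I x B)))))
        where
        c : ℤ
        c = sum (λ t → ι (inc x (lookup blocks t)))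
        alg : ∀ u i c → u * (1ℤ - i) + (i + c) ≡ u + c + (i - i * u)
        alg = solve-∀

      potential′ : potential u′ a′ live′ w ≡ Φ′ B
      potential′ = Σ-cong (λ x → cong₂ _*_ (u′≡ x) (cong (λ z → z * z) (e′≡ x)))
        where
        d′≡ : ∀ x → sum (λ E → I x E * ι (a′ E)) ≡ d x - h x B
        d′≡ x = trans (Σ-cong (λ E → trans (cong (I x E *_) (a′≡ E)) (alg (I x E) (A E) (m E B))))
          (Σ-minus (λ E → I x E * A E) (λ E → I x E * A E * m E B))
          where
          alg : ∀ i a m → i * (a * (1ℤ - m)) ≡ i * a - i * a * m
          alg = solve-∀
        e′≡ : ∀ x → + q * sum (λ E → I x E * ι (a′ E)) - τ′ ≡ e x + (Δ - + q * h x B)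
        e′≡ x = trans (cong (λ z → + q * z - τ′) (d′≡ x)) (alg (+ q) (d x) (h x B) τ τ′)
          where
          alg : ∀ q d h τ τ′ → q * (d - h) - τ′ ≡ q * d - τ + (τ - τ′ - q * h)
          alg = solve-∀

      Φ′≤ : + v * Φ′ B ≤ + (v ℕ.+ K₁) * Φ + + K₂ * (Q * Q)
      Φ′≤ = ≤-trans (potential-growth {N} {Φ} {Φ′ B} {n} {+ v} {+ D} {+ l} {+ k} {+ q} {Δ} {κ} {+ Γ} 0<N 0≤Φ (≤-trans (0≤+ℕ _) (≤-reflexive (sym n≡))) (0≤+ℕ v) (0≤+ℕ D) (0≤+ℕ l) (0≤+ℕ k) 0≤Δ
          κ≤kk (≤-trans (≤-reflexive n≡) (+≤+ kk+w+k≤v))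
          (≤-trans (≤-reflexive (sym (pos-* l v))) (≤-trans (+≤+ lv≤kD) (≤-reflexive (pos-* k D))))
          vD≤ΓN vΔ≤ (proj₂ (proj₂ chosen)))
        (≤-reflexive (cong₂ (λ y z → (+ v + y) * Φ + z * (Q * Q)) (sym K₁≡) (sym K₂≡)))
        where
        kk≡ : + (k ℕ.* k) ≡ + k * + k
        kk≡ = pos-* k k
        kkk≡ : + (k ℕ.* k ℕ.* k) ≡ + k * + k * + k
        kkk≡ = trans (pos-* (k ℕ.* k) k) (cong (_* + k) kk≡)
        K₁≡ : + K₁ ≡ (+ 4 * (+ k * + k) + 1ℤ) * + Γ
        K₁≡ = trans (pos-* (4 ℕ.* (k ℕ.* k) ℕ.+ 1) Γ) (cong (λ z → (z + 1ℤ) * + Γ) (trans (pos-* 4 (k ℕ.* k)) (cong (+ 4 *_) kk≡)))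
        K₂≡ : + K₂ ≡ + 4 * (+ k * + k * + k * (+ k * + k * + k)) + + k * + k * (+ k * + k) + + 2 * (+ k * + k * + k) * + Γ
        K₂≡ = cong₂ _+_ (cong₂ _+_
            (trans (pos-* 4 (k ℕ.* k ℕ.* k ℕ.* (k ℕ.* k ℕ.* k))) (cong (+ 4 *_) (trans (pos-* (k ℕ.* k ℕ.* k) (k ℕ.* k ℕ.* k)) (cong₂ _*_ kkk≡ kkk≡))))
            (trans (pos-* (k ℕ.* k) (k ℕ.* k)) (cong₂ _*_ kk≡ kk≡)))
          (trans (pos-* (2 ℕ.* (k ℕ.* k ℕ.* k)) Γ) (cong (_* + Γ) (trans (pos-* 2 (k ℕ.* k ℕ.* k)) (cong (+ 2 *_) kkk≡))))

      -- The additive term `K₂` Q² of this step is enlarged by (1 + K₁ / v)^(i + 1), the factor that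
      -- the earlier terms have accumulated at most. All i + 1 terms then merge into one
      -- coefficient.
      bound′ : + (v ℕ.^ suc i ℕ.* v) * potential u′ a′ live′ w ≤ + (suc i ℕ.* K₂ ℕ.* (v ℕ.+ K₁) ℕ.^ suc i) * (Q * Q)
      bound′ = begin
        + (v ℕ.^ suc i ℕ.* v) * potential u′ a′ live′ w
          ≡⟨ cong₂ _*_ (trans (cong +_ (alg₁ v (v ℕ.^ i))) (pos-* V v)) potential′ ⟩
        + V * + v * Φ′ B
          ≡⟨ *-assoc (+ V) (+ v) (Φ′ B) ⟩
        + V * (+ v * Φ′ B)
          ≤⟨ *-monoˡ-≤-0≤ (+ V) (0≤+ℕ V) Φ′≤ ⟩
        + V * (+ (v ℕ.+ K₁) * Φ + + K₂ * (Q * Q))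
          ≡⟨ alg₂ (+ V) (+ (v ℕ.+ K₁)) Φ (+ K₂) (Q * Q) ⟩
        + (v ℕ.+ K₁) * (+ V * Φ) + + K₂ * + V * (Q * Q)
          ≤⟨ +-mono-≤ (*-monoˡ-≤-0≤ (+ (v ℕ.+ K₁)) (0≤+ℕ _) bound) (*-monoʳ-≤-nonNeg (Q * Q) {{nonNegative (0≤i² Q)}} (*-monoˡ-≤-0≤ (+ K₂) (0≤+ℕ K₂) (+≤+ V≤G))) ⟩
        + (v ℕ.+ K₁) * (+ (i ℕ.* K₂ ℕ.* (v ℕ.+ K₁) ℕ.^ i) * (Q * Q)) + + K₂ * + ((v ℕ.+ K₁) ℕ.* (v ℕ.+ K₁) ℕ.^ i) * (Q * Q)
          ≡⟨ trans (alg₃ (+ (v ℕ.+ K₁)) (+ (i ℕ.* K₂ ℕ.* (v ℕ.+ K₁) ℕ.^ i)) (+ K₂) (+ ((v ℕ.+ K₁) ℕ.* (v ℕ.+ K₁) ℕ.^ i)) (Q * Q)) (cong (_* (Q * Q)) coeff) ⟩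
        + (suc i ℕ.* K₂ ℕ.* (v ℕ.+ K₁) ℕ.^ suc i) * (Q * Q) ∎
        where
        open ≤-Reasoning
        V : ℕ
        V = v ℕ.^ i ℕ.* v
        alg₁ : ∀ v p → v ℕ.* p ℕ.* v ≡ p ℕ.* v ℕ.* v
        alg₁ = ℕRing.solve-∀
        alg₂ : ∀ V g Φ K Q → V * (g * Φ + K * Q) ≡ g * (V * Φ) + K * V * Q
        alg₂ = solve-∀
        alg₃ : ∀ g c K G Q → g * (c * Q) + K * G * Q ≡ (g * c + K * G) * Q
        alg₃ = solve-∀
        V≤G : V ℕ.≤ (v ℕ.+ K₁) ℕ.* (v ℕ.+ K₁) ℕ.^ i
        V≤G = ℕ.≤-trans (ℕ.≤-reflexive (ℕ.*-comm (v ℕ.^ i) v)) (ℕ.^-monoˡ-≤ (suc i) (ℕ.m≤m+n v K₁))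
        coeff : + (v ℕ.+ K₁) * + (i ℕ.* K₂ ℕ.* (v ℕ.+ K₁) ℕ.^ i) + + K₂ * + ((v ℕ.+ K₁) ℕ.* (v ℕ.+ K₁) ℕ.^ i) ≡
          + (suc i ℕ.* K₂ ℕ.* (v ℕ.+ K₁) ℕ.^ suc i)
        coeff = trans (cong₂ _+_ (sym (pos-* (v ℕ.+ K₁) (i ℕ.* K₂ ℕ.* (v ℕ.+ K₁) ℕ.^ i))) (sym (pos-* K₂ ((v ℕ.+ K₁) ℕ.* (v ℕ.+ K₁) ℕ.^ i))))
          (cong +_ (alg₄ (v ℕ.+ K₁) i K₂ ((v ℕ.+ K₁) ℕ.^ i)))
          where
          alg₄ : ∀ g i K p → g ℕ.* (i ℕ.* K ℕ.* p) ℕ.+ K ℕ.* (g ℕ.* p) ≡ (1 ℕ.+ i) ℕ.* K ℕ.* (g ℕ.* p)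
          alg₄ = ℕRing.solve-∀

      next : State (suc i) w
      next = record
        { blocks = B ∷ blocks ; u = u′ ; a = a′ ; live = live′ ; count = count′ ; cover = cover′ ; bound = bound′ }

    -- Undoing a choice returns k points to the uncovered set, so `active` at the last stage implies
    -- it at all earlier ones.
    states : v₀ ℕ.≤ v → ∀ i w → v ≡ k ℕ.* k ℕ.+ k ℕ.* i ℕ.+ w → v ℕ.≤ 2 ℕ.* k ℕ.* (k ℕ.* k ℕ.+ w) → State i w
    states v₀≤v zero    w v-split active = subst (State 0) (ℕ.+-cancelˡ-≡ (k ℕ.* k) w₀ w
      (trans (sym v≡) (trans v-split (cong (ℕ._+ w) (trans (cong (k ℕ.* k ℕ.+_) (ℕ.*-zeroʳ k)) (ℕ.+-identityʳ (k ℕ.* k))))))) initial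
    states v₀≤v (suc i) w v-split active = Step.next v₀≤v v-split active
      (states v₀≤v i (w ℕ.+ k) (trans v-split (alg k i w))
        (ℕ.≤-trans active (ℕ.*-monoʳ-≤ (2 ℕ.* k) (ℕ.+-monoʳ-≤ (k ℕ.* k) (ℕ.m≤m+n w k)))))
      where
      alg : ∀ k i w → k ℕ.* k ℕ.+ k ℕ.* (1 ℕ.+ i) ℕ.+ w ≡ k ℕ.* k ℕ.+ k ℕ.* i ℕ.+ (w ℕ.+ k)
      alg = ℕRing.solve-∀

-- Degrees and codegrees of a Steiner system

module SteinerDegrees where

  open import Defs
  open import Data.Bool.Base using (Bool; true; false; _∧_)
  open import Data.Fin.Base using (Fin; zero; suc)
  open import Data.Fin.Properties using () renaming (_≟_ to _≟F_)
  open import Data.Fin.Subset using (Subset; inside; _⊆_; ⊥; ⊤) renaming (∣_∣ to size)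
  open import Data.Fin.Subset.Properties using (∣⊥∣≡0; ∣⊤∣≡n; drop-there)
  open import Data.Integer.Base hiding (suc; _^_)
  open import Data.Integer.Properties
  open import Data.Integer.Tactic.RingSolver using (solve-∀)
  import Data.Nat.Base as ℕ
  import Data.Nat.Properties as ℕ
  open import Data.Nat.Base using (ℕ; zero; suc; z≤n; s≤s)
  open import Data.Product using (∃; _×_; _,_; proj₁; proj₂)
  open import Data.Vec.Base using ([]; _∷_; lookup; _[_]≔_; here; there)
  open import Data.Vec.Properties using (lookup∘update′)
  open import Relation.Nullary using (contradiction; yes; no; does)
  open import Relation.Binary.PropositionalEquality
  open import Algebra.Properties.Semiring.Sum +-*-semiring using (sum)
  open IntegerSums
  open RegularHypergraph using (module Regular)

  -- A Boolean test for inclusion, so that the blocks above a given set can be counted with `ι`.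
  sub : ∀ {n} → Subset n → Subset n → Bool
  sub []          []      = true
  sub (true ∷ S)  (y ∷ p) = y ∧ sub S p
  sub (false ∷ S) (y ∷ p) = sub S p

  sub-⊆ : ∀ {n} {S p : Subset n} → sub S p ≡ true → S ⊆ p
  sub-⊆ {S = true ∷ S} {true ∷ p} sub≡ here = here
  sub-⊆ {S = true ∷ S} {true ∷ p} sub≡ (there x∈S) = there (sub-⊆ sub≡ x∈S)
  sub-⊆ {S = false ∷ S} {y ∷ p} sub≡ (there x∈S) = there (sub-⊆ sub≡ x∈S)

  ⊆-sub : ∀ {n} {S p : Subset n} → S ⊆ p → sub S p ≡ true
  ⊆-sub {S = []} {[]} S⊆p = refl
  ⊆-sub {S = true ∷ S} {y ∷ p} S⊆p with S⊆p here
  ... | here = ⊆-sub (λ x∈S → drop-there (S⊆p (there x∈S)))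
  ⊆-sub {S = false ∷ S} {y ∷ p} S⊆p = ⊆-sub (λ x∈S → drop-there (S⊆p (there x∈S)))

  sub-⊥ : ∀ {n} (p : Subset n) → sub ⊥ p ≡ true
  sub-⊥ []      = refl
  sub-⊥ (y ∷ p) = sub-⊥ p

  sub-insert : ∀ {n} (S p : Subset n) x → lookup S x ≡ false → sub (S [ x ]≔ inside) p ≡ lookup p x ∧ sub S p
  sub-insert (false ∷ S) (y ∷ p) zero    x∉S = refl
  sub-insert (false ∷ S) (y ∷ p) (suc x) x∉S = sub-insert S p x x∉S
  sub-insert (true ∷ S) (false ∷ p) (suc x) x∉S = go (lookup p x)
    where
    go : ∀ c → false ≡ c ∧ false
    go true  = refl
    go false = refl
  sub-insert (true ∷ S) (true ∷ p) (suc x) x∉S = sub-insert S p x x∉S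

  size-insert : ∀ {n} (S : Subset n) x → lookup S x ≡ false → size (S [ x ]≔ inside) ≡ suc (size S)
  size-insert (false ∷ S) zero    x∉S = refl
  size-insert (true ∷ S)  (suc x) x∉S = cong suc (size-insert S x x∉S)
  size-insert (false ∷ S) (suc x) x∉S = size-insert S x x∉S

  lookup-⊥ : ∀ {n} (x : Fin n) → lookup (⊥ {n}) x ≡ false
  lookup-⊥ zero    = refl
  lookup-⊥ (suc x) = lookup-⊥ x

  Σ-size : ∀ {n} (p : Subset n) → sum (λ x → ι (lookup p x)) ≡ + size p
  Σ-size []          = refl
  Σ-size (true ∷ p)  = cong (_+_ 1ℤ) (Σ-size p)
  Σ-size (false ∷ p) = trans (+-identityˡ _) (Σ-size p)

  subset-of-size : ∀ {n} (p : Subset n) s → s ℕ.≤ size p → ∃ λ S → S ⊆ p × size S ≡ s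
  subset-of-size p s s≤ with go p s s≤
    where
    go : ∀ {n} (p : Subset n) s → s ℕ.≤ size p → ∃ λ S → sub S p ≡ true × size S ≡ s
    go []          zero    z≤n      = [] , refl , refl
    go (false ∷ p) s       s≤       with go p s s≤
    ... | S , S⊆p , ∣S∣≡s = false ∷ S , S⊆p , ∣S∣≡s
    go (true ∷ p)  zero    z≤n      with go p zero z≤n
    ... | S , S⊆p , ∣S∣≡s = false ∷ S , S⊆p , ∣S∣≡s
    go (true ∷ p)  (suc s) (s≤s s≤) with go p s s≤
    ... | S , S⊆p , ∣S∣≡s = true ∷ S , S⊆p , cong suc ∣S∣≡s
  ... | S , S⊆p , ∣S∣≡s = S , sub-⊆ S⊆p , ∣S∣≡s

  module Design {t k v b : ℕ} {B : Fin b → Subset v} (steiner : IsSteiner t k v b B) where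

    2≤t : 2 ℕ.≤ t
    2≤t = proj₁ steiner
    t<k : t ℕ.< k
    t<k = proj₁ (proj₂ steiner)
    k<v : k ℕ.< v
    k<v = proj₁ (proj₂ (proj₂ steiner))
    ∣B∣≡k : ∀ E → size (B E) ≡ k
    ∣B∣≡k = proj₁ (proj₂ (proj₂ (proj₂ steiner)))
    unique : ∀ T → size T ≡ t → ∃ λ E → T ⊆ B E × (∀ F → T ⊆ B F → F ≡ E)
    unique = proj₂ (proj₂ (proj₂ (proj₂ steiner)))

    inc : Fin v → Fin b → Bool
    inc x E = lookup (B E) x

    I : Fin v → Fin b → ℤ
    I x E = ι (inc x E)

    deg : Subset v → ℤ
    deg S = sum (λ E → ι (sub S (B E)))

    deg-insert : ∀ S x → lookup S x ≡ false → deg (S [ x ]≔ inside) ≡ sum (λ E → I x E * ι (sub S (B E)))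
    deg-insert S x x∉S = Σ-cong (λ E → trans (cong ι (sub-insert S (B E) x x∉S)) (ι-∧ (inc x E) (sub S (B E))))

    Σ∖ : ∀ {n} (S p : Subset n) → sub S p ≡ true → sum (λ x → ι (lookup p x) * (1ℤ - ι (lookup S x))) ≡ + size p - + size S
    Σ∖ []          []          _    = refl
    Σ∖ (true ∷ S)  (true ∷ p)  S⊆p  = trans (+-identityˡ _) (trans (Σ∖ S p S⊆p) (alg (+ size p) (+ size S)))
      where
      alg : ∀ p s → p - s ≡ 1ℤ + p - (1ℤ + s)
      alg = solve-∀
    Σ∖ (false ∷ S) (true ∷ p)  S⊆p  = trans (cong (_+_ 1ℤ) (Σ∖ S p S⊆p)) (sym (+-assoc 1ℤ (+ size p) (- + size S)))
    Σ∖ (false ∷ S) (false ∷ p) S⊆p  = trans (+-identityˡ _) (Σ∖ S p S⊆p)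

    -- Both sides count pairs of a block containing `S` and a point of that block outside `S`.
    double-count : ∀ S c → (∀ x → lookup S x ≡ false → deg (S [ x ]≔ inside) ≡ c) →
      (+ k - + size S) * deg S ≡ (+ v - + size S) * c
    double-count S c h = begin
      (+ k - + size S) * deg S
        ≡⟨ Σ-*ˡ (+ k - + size S) (λ E → σ E) ⟨
      sum (λ E → (+ k - + size S) * σ E)
        ≡⟨ Σ-cong perBlock ⟩
      sum (λ E → sum (λ x → (1ℤ - ι (lookup S x)) * (I x E * σ E)))
        ≡⟨ Σ-swap (λ E x → (1ℤ - ι (lookup S x)) * (I x E * σ E)) ⟩
      sum (λ x → sum (λ E → (1ℤ - ι (lookup S x)) * (I x E * σ E)))
        ≡⟨ Σ-cong (λ x → Σ-*ˡ (1ℤ - ι (lookup S x)) (λ E → I x E * σ E)) ⟩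
      sum (λ x → (1ℤ - ι (lookup S x)) * sum (λ E → I x E * σ E))
        ≡⟨ Σ-cong perPoint ⟩
      sum (λ x → (1ℤ - ι (lookup S x)) * c)
        ≡⟨ Σ-*ʳ c (λ x → 1ℤ - ι (lookup S x)) ⟩
      sum (λ x → 1ℤ - ι (lookup S x)) * c
        ≡⟨ cong (_* c) (trans (Σ-minus (λ x → 1ℤ) (λ x → ι (lookup S x))) (cong₂ _-_ (trans (Σ-const v 1ℤ) (*-identityʳ (+ v))) (Σ-size S))) ⟩
      (+ v - + size S) * c ∎
      where
      open ≡-Reasoning
      σ : Fin b → ℤ
      σ E = ι (sub S (B E))
      perBlock : ∀ E → (+ k - + size S) * σ E ≡ sum (λ x → (1ℤ - ι (lookup S x)) * (I x E * σ E))
      perBlock E with sub S (B E) in S⊆E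
      ... | true = trans (*-identityʳ _) (trans (cong (λ z → + z - + size S) (sym (∣B∣≡k E))) (trans (sym (Σ∖ S (B E) S⊆E))
            (Σ-cong (λ x → alg′ (I x E) (ι (lookup S x))))))
        where
        alg′ : ∀ i s → i * (1ℤ - s) ≡ (1ℤ - s) * (i * 1ℤ)
        alg′ = solve-∀
      ... | false = trans (*-zeroʳ (+ k - + size S)) (sym (trans (Σ-cong (λ x → alg′ (I x E) (ι (lookup S x)))) (trans (Σ-const v 0ℤ) (*-zeroʳ (+ v)))))
        where
        alg′ : ∀ i s → (1ℤ - s) * (i * 0ℤ) ≡ 0ℤ
        alg′ = solve-∀
      perPoint : ∀ x → (1ℤ - ι (lookup S x)) * sum (λ E → I x E * σ E) ≡ (1ℤ - ι (lookup S x)) * c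
      perPoint x with lookup S x in x∉S
      ... | true  = refl
      ... | false = cong (_*_ 1ℤ) (trans (sym (deg-insert S x x∉S)) (h x x∉S))

    -- Downward induction on the size, starting from sets of size t, which lie in exactly one block.
    -- `double-count` determines (k - s) times the degree, and s < k allows cancellation.
    deg-const : ∀ r s → s ℕ.+ r ≡ t → ∃ λ c → ∀ S → size S ≡ s → deg S ≡ c
    deg-const zero s s≡t = 1ℤ , λ S ∣S∣≡s → one S (trans ∣S∣≡s (trans (sym (ℕ.+-identityʳ s)) s≡t))
      where
      one : ∀ S → size S ≡ t → deg S ≡ 1ℤ
      one S ∣S∣≡t with unique S ∣S∣≡t
      ... | E , S⊆E , E! = trans (Σ-cong point) (Σ-δ (λ _ → 1ℤ) E)
        where
        point : ∀ F → ι (sub S (B F)) ≡ 1ℤ * ι (does (E ≟F F))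
        point F with E ≟F F
        ... | yes refl = cong ι (⊆-sub S⊆E)
        ... | no E≢F with sub S (B F) in S⊆F
        ...   | false = refl
        ...   | true  = contradiction (sym (E! F (sub-⊆ S⊆F))) E≢F
    deg-const (suc r) s s+r≡t with deg-const r (suc s) (trans (sym (ℕ.+-suc s r)) s+r≡t) | subset-of-size (⊤ {v}) s s≤v
      where
      s≤v : s ℕ.≤ size (⊤ {v})
      s≤v = subst (s ℕ.≤_) (sym (∣⊤∣≡n v)) (ℕ.≤-trans (ℕ.m≤m+n s (suc r)) (ℕ.≤-trans (ℕ.≤-reflexive s+r≡t) (ℕ.<⇒≤ (ℕ.<-trans t<k k<v))))
    -- The constant is taken to be the degree of a sample set `S₀`, which avoids forming a quotient.
    ... | c , const | S₀ , _ , ∣S₀∣≡s = deg S₀ , λ S ∣S∣≡s → *-cancelˡ-≡ (+ k - + s) (deg S) (deg S₀) {{k-s≢0}} (trans (relation S ∣S∣≡s) (sym (relation S₀ ∣S₀∣≡s)))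
      where
      s<k : s ℕ.< k
      s<k = ℕ.≤-<-trans (ℕ.≤-trans (ℕ.m≤m+n s (suc r)) (ℕ.≤-reflexive s+r≡t)) t<k
      k-s≢0 : NonZero (+ k - + s)
      k-s≢0 = ≢-nonZero (λ eq → ℕ.<⇒≢ s<k (+-injective (sym (i-j≡0⇒i≡j (+ k) (+ s) eq))))
      relation : ∀ S → size S ≡ s → (+ k - + s) * deg S ≡ (+ v - + s) * c
      relation S refl = double-count S c (λ x x∉S → const (S [ x ]≔ inside) (size-insert S x x∉S))

    0≤deg : ∀ S → 0ℤ ≤ deg S
    0≤deg S = Σ-0≤ (λ E → 0≤ι (sub S (B E)))


    c₁ c₂ : ℤ
    c₁ = proj₁ (deg-const (t ℕ.∸ 1) 1 (ℕ.m+[n∸m]≡n (ℕ.<⇒≤ 2≤t)))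
    c₂ = proj₁ (deg-const (t ℕ.∸ 2) 2 (ℕ.m+[n∸m]≡n 2≤t))

    deg₁ : ∀ S → size S ≡ 1 → deg S ≡ c₁
    deg₁ = proj₂ (deg-const (t ℕ.∸ 1) 1 (ℕ.m+[n∸m]≡n (ℕ.<⇒≤ 2≤t)))

    deg₂ : ∀ S → size S ≡ 2 → deg S ≡ c₂
    deg₂ = proj₂ (deg-const (t ℕ.∸ 2) 2 (ℕ.m+[n∸m]≡n 2≤t))

    0≤c : ∀ s {c} → s ℕ.≤ v → (∀ S → size S ≡ s → deg S ≡ c) → 0ℤ ≤ c
    0≤c s s≤v const with subset-of-size (⊤ {v}) s (subst (s ℕ.≤_) (sym (∣⊤∣≡n v)) s≤v)
    ... | S , _ , ∣S∣≡s = ≤-trans (0≤deg S) (≤-reflexive (const S ∣S∣≡s))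

    2≤v : 2 ℕ.≤ v
    2≤v = ℕ.≤-trans 2≤t (ℕ.<⇒≤ (ℕ.<-trans t<k k<v))

    0≤c₁ : 0ℤ ≤ c₁
    0≤c₁ = 0≤c 1 (ℕ.<⇒≤ 2≤v) deg₁

    0≤c₂ : 0ℤ ≤ c₂
    0≤c₂ = 0≤c 2 2≤v deg₂

    D l : ℕ
    D = ∣ c₁ ∣
    l = ∣ c₂ ∣

    singleton : Fin v → Subset v
    singleton x = ⊥ [ x ]≔ inside

    size-singleton : ∀ x → size (singleton x) ≡ 1
    size-singleton x = trans (size-insert ⊥ x (lookup-⊥ x)) (cong suc (∣⊥∣≡0 v))

    sub-singleton : ∀ x E → ι (sub (singleton x) (B E)) ≡ I x E
    sub-singleton x E = trans (cong ι (trans (sub-insert ⊥ (B E) x (lookup-⊥ x)) (cong (inc x E ∧_) (sub-⊥ (B E)))))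
      (trans (ι-∧ (inc x E) true) (*-identityʳ (I x E)))

    degree : ∀ x → sum (λ E → I x E) ≡ + D
    degree x = trans (Σ-cong (λ E → sym (sub-singleton x E))) (trans (deg₁ (singleton x) (size-singleton x)) (sym (0≤i⇒+∣i∣≡i 0≤c₁)))

    codegree : ∀ x y → x ≢ y → sum (λ E → I x E * I y E) ≡ + l
    codegree x y x≢y = begin
      sum (λ E → I x E * I y E)                      ≡⟨ Σ-cong (λ E → trans (*-comm (I x E) (I y E)) (cong (I y E *_) (sym (sub-singleton x E)))) ⟩
      sum (λ E → I y E * ι (sub (singleton x) (B E))) ≡⟨ deg-insert (singleton x) y y∉ ⟨
      deg (singleton x [ y ]≔ inside)                ≡⟨ deg₂ (singleton x [ y ]≔ inside) (trans (size-insert (singleton x) y y∉) (cong suc (size-singleton x))) ⟩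
      c₂                                             ≡⟨ 0≤i⇒+∣i∣≡i 0≤c₂ ⟨
      + l                                            ∎
      where
      open ≡-Reasoning
      y∉ : lookup (singleton x) y ≡ false
      y∉ = trans (lookup∘update′ (λ y≡x → x≢y (sym y≡x)) ⊥ inside) (lookup-⊥ y)

    regular : Regular.IsRegular inc (+ k) (+ D) (+ l)
    regular = record
      { 0≤D = 0≤+ℕ D
      ; 0≤l = 0≤+ℕ l
      ; size = λ E → trans (Σ-size (B E)) (cong +_ (∣B∣≡k E))
      ; degree = degree
      ; codeg = λ x f 0≤f → begin
          sum (λ y → f y * sum (λ E → I x E * I y E))            ≤⟨ Σ-mono (pointwise x f 0≤f) ⟩
          sum (λ y → + l * f y + + D * (f y * ι (does (x ≟F y)))) ≡⟨ Σ-+ (λ y → + l * f y) (λ y → + D * (f y * ι (does (x ≟F y)))) ⟩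
          sum (λ y → + l * f y) + sum (λ y → + D * (f y * ι (does (x ≟F y))))
            ≡⟨ cong₂ _+_ (Σ-*ˡ (+ l) f) (trans (Σ-*ˡ (+ D) (λ y → f y * ι (does (x ≟F y)))) (cong (+ D *_) (Σ-δ f x))) ⟩
          + l * sum f + + D * f x                                ∎
      }
      where
      open ≤-Reasoning
      pointwise : ∀ x f → (∀ y → 0ℤ ≤ f y) → ∀ y → f y * sum (λ E → I x E * I y E) ≤ + l * f y + + D * (f y * ι (does (x ≟F y)))
      pointwise x f 0≤f y with x ≟F y
      ... | yes refl = begin
          f x * sum (λ E → I x E * I x E)  ≡⟨ cong (f x *_) (trans (Σ-cong (λ E → ι-idem (inc x E))) (degree x)) ⟩
          f x * + D                        ≤⟨ ≤-by (+ l * f x) (0≤+* l (0≤f x)) (alg (f x) (+ D) (+ l)) ⟩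
          + l * f x + + D * (f x * 1ℤ)     ∎
        where
        alg : ∀ f D l → f * D + l * f ≡ l * f + D * (f * 1ℤ)
        alg = solve-∀
      ... | no x≢y = ≤-reflexive (trans (cong (f y *_) (codegree x y x≢y)) (alg (f y) (+ D) (+ l)))
        where
        alg : ∀ f D l → f * l ≡ l * f + D * (f * 0ℤ)
        alg = solve-∀

    1≤D : 1 ℕ.≤ D
    1≤D with D in D≡
    ... | suc _ = s≤s z≤n
    ... | zero  with subset-of-size (⊤ {v}) t (subst (t ℕ.≤_) (sym (∣⊤∣≡n v)) (ℕ.<⇒≤ (ℕ.<-trans t<k k<v)))
    ...   | T , _ , ∣T∣≡t = contradiction (≤-trans (≤-reflexive (trans (cong +_ (sym (∣B∣≡k E))) (sym (Σ-size (B E))))) (Σ-≤0 empty)) (<⇒≱ (+<+ (ℕ.≤-<-trans z≤n t<k)))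
      where
      E : Fin b
      E = proj₁ (unique T ∣T∣≡t)
      empty : ∀ x → I x E ≤ 0ℤ
      empty x = ≤-trans (term≤Σ {f = I x} (λ F → 0≤ι (inc x F)) E) (≤-reflexive (trans (degree x) (cong +_ D≡)))

    -- Double counting gives (k - 1) c₁ = (v - 1) c₂. As k ≤ v, this forces c₂ ≤ c₁, and adding that
    -- inequality replaces v - 1 and k - 1 by v and k.
    lv≤kD : l ℕ.* v ℕ.≤ k ℕ.* D
    lv≤kD = drop‿+≤+ (begin
      + (l ℕ.* v)                           ≡⟨ trans (pos-* l v) (cong (_* + v) (0≤i⇒+∣i∣≡i 0≤c₂)) ⟩
      c₂ * + v                              ≡⟨ alg₁ c₂ (+ v) ⟩
      (+ v - 1ℤ) * c₂ + c₂                  ≡⟨ cong (_+ c₂) relation ⟨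
      (+ k - 1ℤ) * c₁ + c₂                  ≤⟨ +-monoʳ-≤ ((+ k - 1ℤ) * c₁) c₂≤c₁ ⟩
      (+ k - 1ℤ) * c₁ + c₁                  ≡⟨ alg₂ (+ k) c₁ ⟩
      + k * c₁                              ≡⟨ trans (pos-* k D) (cong (+ k *_) (0≤i⇒+∣i∣≡i 0≤c₁)) ⟨
      + (k ℕ.* D)                           ∎)
      where
      open ≤-Reasoning
      alg₁ : ∀ c v → c * v ≡ (v - 1ℤ) * c + c
      alg₁ = solve-∀
      alg₂ : ∀ k c → (k - 1ℤ) * c + c ≡ k * c
      alg₂ = solve-∀
      relation : (+ k - 1ℤ) * c₁ ≡ (+ v - 1ℤ) * c₂
      relation with subset-of-size (⊤ {v}) 1 (subst (1 ℕ.≤_) (sym (∣⊤∣≡n v)) (ℕ.<⇒≤ 2≤v))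
      ... | S , _ , ∣S∣≡1 = begin-equality
        (+ k - 1ℤ) * c₁               ≡⟨ cong₂ (λ s c → (+ k - + s) * c) ∣S∣≡1 (deg₁ S ∣S∣≡1) ⟨
        (+ k - + size S) * deg S      ≡⟨ double-count S c₂ (λ x x∉S → deg₂ (S [ x ]≔ inside) (trans (size-insert S x x∉S) (cong suc ∣S∣≡1))) ⟩
        (+ v - + size S) * c₂         ≡⟨ cong (λ s → (+ v - + s) * c₂) ∣S∣≡1 ⟩
        (+ v - 1ℤ) * c₂               ∎
      c₂≤c₁ : c₂ ≤ c₁
      c₂≤c₁ = *-cancelˡ-≤-pos c₂ c₁ (+ v - 1ℤ) {{positive (<-≤-trans (+<+ (s≤s z≤n)) (+-monoˡ-≤ (- 1ℤ) (+≤+ 2≤v)))}}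
        (≤-trans (≤-reflexive (sym relation)) (*-monoʳ-≤-nonNeg c₁ {{nonNegative 0≤c₁}} (+-monoˡ-≤ (- 1ℤ) (+≤+ (ℕ.<⇒≤ k<v)))))

-- The strategy of the cops and why it locates the robber

module LocalizationGame where

  open import Defs
  open import Data.Bool.Base using (Bool; true; false; not; T; if_then_else_)
  open import Data.Bool.Properties using (T?)
  open import Data.Fin.Base using (Fin; zero; suc; toℕ; fromℕ<; inject≤)
  open import Data.Fin.Properties using (toℕ<n; fromℕ<-toℕ)
  open import Data.Fin.Subset using (Subset) renaming (_∈_ to _∈ₛ_)
  import Data.Integer.Base as ℤ
  import Data.Integer.Properties as ℤ
  open import Data.Integer.Base using (ℤ; +_; 0ℤ; 1ℤ)
  open import Data.List.Base using (List; []; _∷_; length; map; filterᵇ; tabulate; allFin; upTo; last; _∷ʳ_)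
  open import Data.List.Properties using (length-map; length-upTo; upTo-∷ʳ; map-++)
  open import Data.List.Membership.Propositional using (_∈_)
  open import Data.List.Membership.Propositional.Properties using (∈-map⁺; ∈-filter⁺; ∈-allFin)
  open import Data.List.Relation.Unary.Any using () renaming (here to hereₗ; there to thereₗ)
  open import Data.Maybe.Base using (Maybe; just; nothing)
  open import Data.Nat.Base
  open import Data.Nat.Properties
  open import Data.Product using (∃; ∃-syntax; _×_; _,_; proj₁; proj₂)
  open import Data.Sum using (_⊎_; inj₁; inj₂)
  open import Data.Unit using (tt)
  open import Data.Vec.Base as Vec using (Vec; []; _∷_; lookup; padRight)
  open import Data.Vec.Properties using ([]=⇒lookup; lookup⇒[]=; lookup-map)
  open import Function using (_∘_; id)
  open import Relation.Nullary using (contradiction; yes; no)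
  open import Relation.Binary.PropositionalEquality
  open import Algebra.Properties.Semiring.Sum ℤ.+-*-semiring using (sum)
  open IntegerSums hiding (≤-by)
  open RegularHypergraph
  open SteinerDegrees

  lookup-padRight : ∀ {A : Set} {m n} (m≤n : m ≤ n) (d : A) (xs : Vec A m) i → lookup (padRight m≤n d xs) (inject≤ i m≤n) ≡ lookup xs i
  lookup-padRight (s≤s m≤n) d (x ∷ xs) zero    = refl
  lookup-padRight (s≤s m≤n) d (x ∷ xs) (suc i) = lookup-padRight m≤n d xs i

  fit : ∀ {A : Set} → A → List A → ∀ m → Vec A m
  fit d xs       zero    = []
  fit d []       (suc m) = d ∷ fit d [] m
  fit d (x ∷ xs) (suc m) = x ∷ fit d xs m

  lookup-fit : ∀ {A : Set} (d : A) {xs m y} → y ∈ xs → length xs ≤ m → ∃ λ i → lookup (fit d xs m) i ≡ y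
  lookup-fit d (hereₗ refl) (s≤s _) = zero , refl
  lookup-fit d (thereₗ y∈xs) (s≤s ≤m) with lookup-fit d y∈xs ≤m
  ... | i , eq = suc i , eq

  last-∷ʳ : ∀ {A : Set} (xs : List A) x → last (xs ∷ʳ x) ≡ just x
  last-∷ʳ []           x = refl
  last-∷ʳ (_ ∷ [])     x = refl
  last-∷ʳ (_ ∷ y ∷ xs) x = last-∷ʳ (y ∷ xs) x

  length-filterᵇ : ∀ {A : Set} {n} (f : Fin n → A) (p : A → Bool) → + length (filterᵇ p (tabulate f)) ≡ sum (λ i → ι (p (f i)))
  length-filterᵇ {n = zero}  f p = refl
  length-filterᵇ {n = suc n} f p with p (f zero)
  ... | true  = cong (ℤ._+_ 1ℤ) (length-filterᵇ (f ∘ suc) p)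
  ... | false = trans (length-filterᵇ (f ∘ suc) p) (sym (ℤ.+-identityˡ _))

  even : ℕ → Bool
  even zero    = true
  even (suc n) = not (even n)

  module _ {V : Set} {Adj : V → V → Set} where

    Dist-zero : ∀ {x y d} → Dist Adj x y d → d ≡ 0 → x ≡ y
    Dist-zero (here , _) refl = refl

    Dist-self : ∀ {x d} → Dist Adj x x d → d ≡ 0
    Dist-self {d = zero}  _          = refl
    Dist-self {d = suc d} (_ , none) = contradiction here (none 0 (s≤s z≤n))

    Dist-≤ : ∀ {x y d n} → Dist Adj x y d → Walk Adj x y n → d ≤ n
    Dist-≤ {d = d} {n} (_ , none) walk with d ≤? n
    ... | yes d≤n = d≤n
    ... | no d≰n  = contradiction walk (none n (≰⇒> d≰n))

  prefix-suc : ∀ {m} (obs : ℕ → Vec ℕ m) i → prefix obs (suc i) ≡ prefix obs i ∷ʳ obs i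
  prefix-suc obs i = trans (cong (map obs) (sym (upTo-∷ʳ i))) (map-++ obs (upTo i) (i ∷ []))

  module Game {t k v b : ℕ} {B : Fin b → Subset v} (steiner : IsSteiner t k v b B)
    {i : ℕ} (blocks : Vec (Fin b) i) (u : Fin v → Bool) {n : ℕ}
    (count : sum (λ x → ι (u x)) ≡ + n)
    (cover : ∀ x → ι (u x) ℤ.+ sum (λ j → ι (lookup (B (lookup blocks j)) x)) ≡ 1ℤ)
    {m : ℕ} (i<m : suc i ≤ m) (n+kk≤m : n + k * k ≤ m) where

    open Design steiner using (inc; I; t<k; k<v; ∣B∣≡k; unique)

    V : Set
    V = Fin v ⊎ Fin b

    isPoint : V → Bool
    isPoint (inj₁ _) = true
    isPoint (inj₂ _) = false

    adj-flips : ∀ {x y} → IncAdj B x y → isPoint y ≡ not (isPoint x)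
    adj-flips {inj₁ _} {inj₂ _} _ = refl
    adj-flips {inj₂ _} {inj₁ _} _ = refl

    same : Bool → Bool → Bool
    same true  p = p
    same false p = not p

    -- The incidence graph is bipartite, so the parity of the distance from any probed point already
    -- tells whether the robber is on a point or on a block.
    walk-parity : ∀ {x y d} → Walk (IncAdj B) x y d → even d ≡ same (isPoint x) (isPoint y)
    walk-parity {x} here with isPoint x
    ... | true  = refl
    ... | false = refl
    walk-parity {x} {y} (step {y = z} x~z walk) rewrite walk-parity walk | adj-flips x~z = go (isPoint x) (isPoint y)
      where
      go : ∀ p r → not (same (not p) r) ≡ same p r
      go true  true  = refl
      go true  false = refl
      go false true  = refl
      go false false = refl

    point₀ : Fin v
    point₀ = fromℕ< (≤-<-trans z≤n k<v)

    point : ℕ → Fin v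
    point r with r <? v
    ... | yes r<v = fromℕ< r<v
    -- From round `v` on every point has had its turn, and any vertex will do.
    ... | no _    = point₀

    point-toℕ : ∀ x → point (toℕ x) ≡ x
    point-toℕ x with toℕ x <? v
    ... | yes r<v = fromℕ<-toℕ x r<v
    ... | no r≮v  = contradiction (toℕ<n x) r≮v

    -- slot₀ carries the sweeping point, slot j the j-th block.
    sweep : ℕ → Vec V m
    sweep r = padRight i<m (inj₁ point₀) (inj₁ (point r) ∷ Vec.map inj₂ blocks)

    slot₀ : Fin m
    slot₀ = inject≤ zero i<m

    slot : Fin i → Fin m
    slot j = inject≤ (suc j) i<m

    sweep-slot₀ : ∀ r → lookup (sweep r) slot₀ ≡ inj₁ (point r)
    sweep-slot₀ r = lookup-padRight i<m (inj₁ point₀) (inj₁ (point r) ∷ Vec.map inj₂ blocks) zero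

    sweep-slot : ∀ r j → lookup (sweep r) (slot j) ≡ inj₂ (lookup blocks j)
    sweep-slot r j = trans (lookup-padRight i<m (inj₁ point₀) (inj₁ (point r) ∷ Vec.map inj₂ blocks) (suc j)) (lookup-map j inj₂ blocks)

    -- Blocks meet exactly when their distance is at most 2.
    hit : Vec ℕ m → Fin i → Bool
    hit w j = lookup w (slot j) ≤ᵇ 2

    -- By `cover` this is the indicator of lying in `U` or in a hit block. Written as a sum, it
    -- gives the number of suspects by exchanging summations.
    weight : Vec ℕ m → Fin v → ℤ
    weight w x = ι (u x) ℤ.+ sum (λ j → ι (hit w j) ℤ.* I x (lookup blocks j))

    suspects : Vec ℕ m → List (Fin v)
    suspects w = filterᵇ (isPos ∘ weight w) (allFin v)

    search : Vec ℕ m → Vec V m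
    search w = fit (inj₁ point₀) (map inj₁ (suspects w)) m

    -- The last answer alone decides between sweeping and searching. After the first search the
    -- entry in `slot₀` need not come from the sweeping point, but by then the robber is located.
    respond : ℕ → Maybe (Vec ℕ m) → Vec V m
    respond r nothing  = sweep r
    respond r (just w) = if even (lookup w slot₀) then sweep r else search w

    σ : Strategy V m
    σ history = respond (length history) (last history)

    σ-suc : ∀ obs r → σ (prefix obs (suc r)) ≡ respond (suc r) (just (obs r))
    σ-suc obs r = cong₂ respond (trans (length-map obs (upTo (suc r))) (length-upTo (suc r)))
      (trans (cong last (prefix-suc obs r)) (last-∷ʳ (prefix obs r) (obs r)))

    -- This guarantees that all rounds up to `i` are sweeps. It speaks of answers only and so
    -- carries over to any other robber who produces the same answers.
    EvenBefore : ℕ → (ℕ → Vec ℕ m) → Set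
    EvenBefore i obs = ∀ r → r < i → even (lookup (obs r) slot₀) ≡ true

    σ-sweep : ∀ obs r → EvenBefore r obs → σ (prefix obs r) ≡ sweep r
    σ-sweep obs zero    _   = refl
    σ-sweep obs (suc r) evn = trans (σ-suc obs r) (cong (if_then sweep (suc r) else search (obs r)) (evn r (n<1+n r)))

    module Play (r : ℕ → V) (obs : ℕ → Vec ℕ m) (walk : RobberWalk (IncAdj B) r)
                (consistent : Consistent (IncAdj B) σ r obs) where

      sweep-dist : ∀ N → EvenBefore N obs → ∀ s → Dist (IncAdj B) (lookup (sweep N) s) (r N) (lookup (obs N) s)
      sweep-dist N evn s = subst (λ z → Dist (IncAdj B) (lookup z s) (r N) (lookup (obs N) s)) (σ-sweep obs N evn) (consistent N s)

      slot₀-dist : ∀ N → EvenBefore N obs → Dist (IncAdj B) (inj₁ (point N)) (r N) (lookup (obs N) slot₀)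
      slot₀-dist N evn = subst (λ z → Dist (IncAdj B) z (r N) (lookup (obs N) slot₀)) (sweep-slot₀ N) (sweep-dist N evn slot₀)

      detects : ∀ N → EvenBefore N obs → even (lookup (obs N) slot₀) ≡ isPoint (r N)
      detects N evn = walk-parity (proj₁ (slot₀-dist N evn))

      module Spotted (N : ℕ) (evn : EvenBefore N obs) (L : Fin b) (rN : r N ≡ inj₂ L) where

        w : Vec ℕ m
        w = obs N

        block-dist : ∀ j → Dist (IncAdj B) (inj₂ (lookup blocks j)) (inj₂ L) (lookup w (slot j))
        block-dist j = subst₂ (λ y z → Dist (IncAdj B) y z (lookup w (slot j))) (sweep-slot N j) rN (sweep-dist N evn (slot j))

        open Regular inc (+ k) (+ Design.D steiner) (+ Design.l steiner) using (meet; 0≤meet)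

        0≤hitI : ∀ x j → 0ℤ ℤ.≤ ι (hit w j) ℤ.* I x (lookup blocks j)
        0≤hitI x j = 0≤* (0≤ι (hit w j)) (0≤ι (inc x (lookup blocks j)))

        0≤weight : ∀ x → 0ℤ ℤ.≤ weight w x
        0≤weight x = 0≤+ (0≤ι (u x)) (Σ-0≤ (0≤hitI x))

        through : ∀ {x E} → x ∈ₛ B E → x ∈ₛ B L → Walk (IncAdj B) (inj₂ E) (inj₂ L) 2
        through {x} x∈E x∈L = step {y = inj₁ x} x∈E (step {y = inj₂ L} x∈L here)

        -- By `cover`, `x` lies in `U` or in a chosen block. Such a block shares `x` with `L`, hence
        -- is within distance 2 and counts as hit.
        suspect : ∀ {x} → x ∈ₛ B L → isPos (weight w x) ≡ true
        suspect {x} x∈L = isPos-true (ℤ.≤-trans (ℤ.≤-reflexive (sym (cover x)))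
          (ℤ.+-monoʳ-≤ (ι (u x)) (Σ-mono pointwise)))
          where
          pointwise : ∀ j → I x (lookup blocks j) ℤ.≤ ι (hit w j) ℤ.* I x (lookup blocks j)
          pointwise j with inc x (lookup blocks j) in x∈E
          ... | false = ℤ.≤-reflexive (sym (ℤ.*-zeroʳ (ι (hit w j))))
          ... | true  with hit w j in h
          ...   | true  = ℤ.≤-refl
          ...   | false = contradiction (subst T h (≤⇒≤ᵇ (Dist-≤ (block-dist j) (through (lookup⇒[]= x _ x∈E) x∈L)))) id

        -- A walk of length at most 2 from one block to another either is trivial, when the block is
        -- `L` itself, or runs through a common point.
        hit≤meet : ∀ j → ι (hit w j) ℤ.≤ meet (lookup blocks j) L
        hit≤meet j with hit w j in h
        ... | false = 0≤meet (lookup blocks j) L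
        ... | true  = common (proj₁ (block-dist j)) (≤ᵇ⇒≤ (lookup w (slot j)) 2 (subst T (sym h) tt))
          where
          common : ∀ {E d} → Walk (IncAdj B) (inj₂ E) (inj₂ L) d → d ≤ 2 → 1ℤ ℤ.≤ meet E L
          common {E} here _ = ℤ.≤-trans (ℤ.+≤+ (≤-<-trans z≤n t<k)) (ℤ.≤-reflexive (sym (trans (Σ-cong (λ x → ι-idem (inc x E)))
            (trans (Σ-size (B E)) (cong +_ (∣B∣≡k E))))))
          common {E} (step {y = inj₁ x} x∈E (step {y = inj₂ F} x∈F here)) _ =
            ℤ.≤-trans (ℤ.≤-reflexive (sym (cong₂ (λ p q → ι p ℤ.* ι q) ([]=⇒lookup x∈E) ([]=⇒lookup x∈F))))
              (term≤Σ {f = λ y → I y E ℤ.* I y F} (λ y → 0≤* (0≤ι (inc y E)) (0≤ι (inc y F))) x)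
          common (step {y = inj₂ F} () _) _
          common (step {y = inj₁ x} _ (step {y = inj₁ _} () _)) _
          common (step {y = inj₁ x} _ (step {y = inj₂ F} _ (step _ _))) (s≤s (s≤s ()))

        -- The chosen blocks are disjoint by `cover`, so they share out the k points of `L`.
        Σmeet≤k : sum (λ j → meet (lookup blocks j) L) ℤ.≤ + k
        Σmeet≤k = begin
          sum (λ j → meet (lookup blocks j) L)
            ≡⟨ Σ-swap (λ j x → I x (lookup blocks j) ℤ.* I x L) ⟩
          sum (λ x → sum (λ j → I x (lookup blocks j) ℤ.* I x L))
            ≤⟨ Σ-mono pointwise ⟩
          sum (λ x → I x L)
            ≡⟨ trans (Σ-size (B L)) (cong +_ (∣B∣≡k L)) ⟩
          + k ∎
          where
          open ℤ.≤-Reasoning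
          pointwise : ∀ x → sum (λ j → I x (lookup blocks j) ℤ.* I x L) ℤ.≤ I x L
          pointwise x = begin
            sum (λ j → I x (lookup blocks j) ℤ.* I x L)   ≡⟨ Σ-*ʳ (I x L) (λ j → I x (lookup blocks j)) ⟩
            c ℤ.* I x L                                   ≤⟨ ℤ.*-monoʳ-≤-nonNeg (I x L) {{ℤ.nonNegative (0≤ι (inc x L))}} c≤1 ⟩
            1ℤ ℤ.* I x L                                  ≡⟨ ℤ.*-identityˡ (I x L) ⟩
            I x L                                         ∎
            where
            c : ℤ
            c = sum (λ j → I x (lookup blocks j))
            c≤1 : c ℤ.≤ 1ℤ
            c≤1 = ℤ.≤-trans (ℤ.i≤j+i c (ι (u x)) {{ℤ.nonNegative (0≤ι (u x))}}) (ℤ.≤-reflexive (cover x))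

        -- At most k blocks are hit, with k points each, in addition to the n uncovered points.
        few-suspects : length (map (inj₁ {B = Fin b}) (suspects w)) ≤ m
        few-suspects = ≤-trans (≤-reflexive (length-map inj₁ (suspects w))) (≤-trans (ℤ.drop‿+≤+ (begin
          + length (suspects w)
            ≡⟨ length-filterᵇ id (isPos ∘ weight w) ⟩
          sum (λ x → ι (isPos (weight w x)))
            ≤⟨ Σ-mono (λ x → isPos-≤ (0≤weight x)) ⟩
          sum (λ x → weight w x)
            ≡⟨ Σ-+ (λ x → ι (u x)) (λ x → sum (λ j → ι (hit w j) ℤ.* I x (lookup blocks j))) ⟩
          sum (λ x → ι (u x)) ℤ.+ sum (λ x → sum (λ j → ι (hit w j) ℤ.* I x (lookup blocks j)))
            ≡⟨ cong₂ ℤ._+_ count (Σ-swap (λ x j → ι (hit w j) ℤ.* I x (lookup blocks j))) ⟩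
          + n ℤ.+ sum (λ j → sum (λ x → ι (hit w j) ℤ.* I x (lookup blocks j)))
            ≡⟨ cong (ℤ._+_ (+ n)) (trans (Σ-cong (λ j → trans (Σ-*ˡ (ι (hit w j)) (λ x → I x (lookup blocks j)))
                 (cong (ι (hit w j) ℤ.*_) (trans (Σ-size (B (lookup blocks j))) (cong +_ (∣B∣≡k (lookup blocks j)))))))
                 (Σ-*ʳ (+ k) (λ j → ι (hit w j)))) ⟩
          + n ℤ.+ sum (λ j → ι (hit w j)) ℤ.* + k
            ≤⟨ ℤ.+-monoʳ-≤ (+ n) (ℤ.*-monoʳ-≤-nonNeg (+ k) (ℤ.≤-trans (Σ-mono hit≤meet) Σmeet≤k)) ⟩
          + n ℤ.+ + k ℤ.* + k
            ≡⟨ cong (ℤ._+_ (+ n)) (ℤ.pos-* k k) ⟨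
          + (n + k * k) ∎)) n+kk≤m)
          where open ℤ.≤-Reasoning

        searched : ∀ {x} → x ∈ₛ B L → ∃ λ s → lookup (search w) s ≡ inj₁ x
        searched {x} x∈L = lookup-fit (inj₁ point₀)
          (∈-map⁺ inj₁ (∈-filter⁺ (T? ∘ isPos ∘ weight w) (∈-allFin x) (subst T (sym (suspect x∈L)) tt))) few-suspects

        σ-search : σ (prefix obs (suc N)) ≡ search w
        σ-search = trans (σ-suc obs N) (cong (if_then sweep (suc N) else search w) (trans (detects N evn) (cong isPoint rN)))

        search-dist : ∀ s → Dist (IncAdj B) (lookup (search w) s) (r (suc N)) (lookup (obs (suc N)) s)
        search-dist s = subst (λ z → Dist (IncAdj B) (lookup z s) (r (suc N)) (lookup (obs (suc N)) s)) σ-search (consistent (suc N) s)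

        moved : r (suc N) ≡ inj₂ L ⊎ ∃ λ x → r (suc N) ≡ inj₁ x × x ∈ₛ B L
        moved with walk N
        ... | inj₁ stay = inj₁ (trans stay rN)
        ... | inj₂ adj rewrite rN with r (suc N)
        ...   | inj₁ x = inj₂ (x , refl , adj)

    Agree : ℕ → (ℕ → Vec ℕ m) → (ℕ → Vec ℕ m) → Set
    Agree N obs obs′ = ∀ j → j ≤ N → obs′ j ≡ obs j

    even-agree : ∀ {N obs obs′} → Agree N obs obs′ → ∀ {j} → j ≤ suc N → EvenBefore j obs → EvenBefore j obs′
    even-agree agree j≤ evn r r<j = trans (cong (λ w → even (lookup w slot₀)) (agree r (≤-pred (≤-trans r<j j≤)))) (evn r r<j)

    -- Any t points of `L` lie in both blocks, and only one block contains them.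
    block-unique : ∀ {L L′} → (∀ {x} → x ∈ₛ B L → x ∈ₛ B L′) → L′ ≡ L
    block-unique {L} {L′} L⊆L′ with subset-of-size (B L) t (≤-trans (<⇒≤ t<k) (≤-reflexive (sym (∣B∣≡k L))))
    ... | S , S⊆L , ∣S∣≡t with unique S ∣S∣≡t
    ...   | E , _ , E! = trans (E! L′ (L⊆L′ ∘ S⊆L)) (sym (E! L S⊆L))

    isBlock : ∀ y → isPoint y ≡ false → ∃ λ L → y ≡ inj₂ L
    isBlock (inj₂ L) _ = L , refl

    -- Distance 0 identifies a robber on a probed point, and all points of `L` and of `L′` are
    -- probed. If both robbers are on blocks after the search, every point of `L` answers 1, so it
    -- lies on `L′` as well and the blocks agree.
    located-after-block : ∀ r obs → RobberWalk (IncAdj B) r → Consistent (IncAdj B) σ r obs →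
      ∀ N → EvenBefore N obs → even (lookup (obs N) slot₀) ≡ false → Located (IncAdj B) σ r obs (suc N)
    located-after-block r obs walk consistent N evn odd r′ obs′ walk′ consistent′ agree
      with isBlock (r N) (trans (sym (Play.detects r obs walk consistent N evn)) odd)
         | isBlock (r′ N) (trans (sym (Play.detects r′ obs′ walk′ consistent′ N evn′)) (trans (cong (λ w → even (lookup w slot₀)) (agree N (n≤1+n N))) odd))
      where
      evn′ : EvenBefore N obs′
      evn′ = even-agree agree (m≤n⇒m≤1+n (n≤1+n N)) evn
    ... | L , rN | L′ , r′N = coincide S.moved S′.moved
      where
      evn′ : EvenBefore N obs′
      evn′ = even-agree agree (m≤n⇒m≤1+n (n≤1+n N)) evn
      module S = Play.Spotted r obs walk consistent N evn L rN
      module S′ = Play.Spotted r′ obs′ walk′ consistent′ N evn′ L′ r′N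
      -- The suspects are computed from the answers alone, so both robbers face the same probes.
      same-dist : ∀ s → Dist (IncAdj B) (lookup (search (obs N)) s) (r′ (suc N)) (lookup (obs (suc N)) s)
      same-dist s = subst₂ (λ w w′ → Dist (IncAdj B) (lookup (search w) s) (r′ (suc N)) (lookup w′ s)) (agree N (n≤1+n N)) (agree (suc N) ≤-refl) (S′.search-dist s)
      found : ∀ {x y z d} → Dist (IncAdj B) x y d → Dist (IncAdj B) x z d → y ≡ x → z ≡ y
      found dist dist′ refl = sym (Dist-zero dist′ (Dist-self dist))
      point-found : ∀ {x} → r (suc N) ≡ inj₁ x → x ∈ₛ B L → r′ (suc N) ≡ r (suc N)
      point-found {x} eq x∈L with S.searched x∈L
      ... | s , at-s = found (S.search-dist s) (same-dist s) (trans eq (sym at-s))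
      point-found′ : ∀ {x} → r′ (suc N) ≡ inj₁ x → x ∈ₛ B L′ → r′ (suc N) ≡ r (suc N)
      point-found′ {x} eq x∈L′ with S′.searched x∈L′
      ... | s , at-s = sym (found (same-dist s) (S.search-dist s)
        (trans eq (trans (sym at-s) (cong (λ w → lookup (search w) s) (agree N (n≤1+n N))))))
      coincide : r (suc N) ≡ inj₂ L ⊎ (∃ λ x → r (suc N) ≡ inj₁ x × x ∈ₛ B L) →
                r′ (suc N) ≡ inj₂ L′ ⊎ (∃ λ x → r′ (suc N) ≡ inj₁ x × x ∈ₛ B L′) → r′ (suc N) ≡ r (suc N)
      coincide (inj₂ (x , eq , x∈L)) _ = point-found eq x∈L
      coincide (inj₁ _) (inj₂ (x , eq , x∈L′)) = point-found′ eq x∈L′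
      coincide (inj₁ eq) (inj₁ eq′) = trans eq′ (trans (cong inj₂ (block-unique L⊆L′)) (sym eq))
        where
        one-step : ∀ {x d} → Dist (IncAdj B) (inj₁ x) (inj₂ L) d → Dist (IncAdj B) (inj₁ x) (inj₂ L′) d → x ∈ₛ B L → x ∈ₛ B L′
        one-step dist dist′ x∈L with Dist-≤ dist (step {y = inj₂ L} x∈L here)
        one-step dist (step {y = inj₂ _} x∈L′ here , _) x∈L | s≤s z≤n = x∈L′
        L⊆L′ : ∀ {x} → x ∈ₛ B L → x ∈ₛ B L′
        L⊆L′ x∈L with S.searched x∈L
        ... | s , at-s = one-step
          (subst₂ (λ y z → Dist (IncAdj B) y z (lookup (obs (suc N)) s)) at-s eq (S.search-dist s))
          (subst₂ (λ y z → Dist (IncAdj B) y z (lookup (obs (suc N)) s)) at-s eq′ (same-dist s)) x∈L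

    located-on-points : ∀ r obs → RobberWalk (IncAdj B) r → Consistent (IncAdj B) σ r obs →
      EvenBefore v obs → ∃[ N ] Located (IncAdj B) σ r obs N
    located-on-points r obs walk consistent evn = toℕ x , located
      where
      open Play r obs walk consistent
      0<v : 0 < v
      0<v = ≤-<-trans z≤n k<v
      evn≤ : ∀ {N} → N ≤ v → EvenBefore N obs
      evn≤ N≤v j j<N = evn j (<-≤-trans j<N N≤v)
      isPt : ∀ N → N < v → isPoint (r N) ≡ true
      isPt N N<v = trans (sym (detects N (evn≤ (<⇒≤ N<v)))) (evn N N<v)
      stays : ∀ N → N < v → r N ≡ r 0
      stays zero    _   = refl
      stays (suc N) N<v with walk N
      ... | inj₁ stay = trans stay (stays N (<-trans (n<1+n N) N<v))
      ... | inj₂ adj  = contradiction (trans (sym (isPt (suc N) N<v)) (trans (adj-flips adj) (cong not (isPt N (<-trans (n<1+n N) N<v))))) λ ()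
      start : ∃ λ x → r 0 ≡ inj₁ x
      start with r 0 | isPt 0 0<v
      ... | inj₁ x | _ = x , refl
      x : Fin v
      x = proj₁ start
      N : ℕ
      N = toℕ x
      N<v : N < v
      N<v = toℕ<n x
      rN : r N ≡ inj₁ x
      rN = trans (stays N N<v) (proj₂ start)
      zero-dist : lookup (obs N) slot₀ ≡ 0
      zero-dist = Dist-self (subst₂ (λ y z → Dist (IncAdj B) (inj₁ y) z (lookup (obs N) slot₀)) (point-toℕ x) rN (slot₀-dist N (evn≤ (<⇒≤ N<v))))
      located : Located (IncAdj B) σ r obs N
      located r′ obs′ walk′ consistent′ agree = trans (sym (Dist-zero
        (Play.slot₀-dist r′ obs′ walk′ consistent′ N (even-agree agree (n≤1+n N) (evn≤ (<⇒≤ N<v))))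
        (trans (cong (λ w → lookup w slot₀) (agree N ≤-refl)) zero-dist)))
        (trans (cong inj₁ (point-toℕ x)) (sym rN))

    winning : Winning (IncAdj B) σ
    winning r obs walk consistent = go v 0 (+-identityʳ v) (λ _ ())
      where
      go : ∀ fuel N → fuel + N ≡ v → EvenBefore N obs → ∃[ N ] Located (IncAdj B) σ r obs N
      go zero       N refl evn = located-on-points r obs walk consistent evn
      go (suc fuel) N eq   evn with even (lookup (obs N) slot₀) in detects
      ... | false = suc N , located-after-block r obs walk consistent N evn detects
      ... | true  = go fuel (suc N) (trans (+-suc fuel N) eq) extend
        where
        extend : EvenBefore (suc N) obs
        extend j j≤N with m≤n⇒m<n∨m≡n (≤-pred j≤N)
        ... | inj₁ j<N  = evn j j<N
        ... | inj₂ refl = detects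

    cops-win : CopsWin (IncAdj B) m
    cops-win = σ , winning

-- Choice of parameters and the final bounds

open import Defs
open import Data.Nat.Base
open import Data.Nat.Properties
open import Data.Nat.DivMod using (m≡m%n+[m/n]*n; m%n<n; m/n*n≤m; /-monoˡ-≤; m*n/n≡m)
open import Data.Nat.Tactic.RingSolver using (solve-∀)
open import Data.Fin.Base using (Fin)
open import Data.Fin.Subset using (Subset)
open import Data.Product using (_×_; _,_; ∃-syntax)
open import Relation.Binary.PropositionalEquality
open GreedyMatching
open SteinerDegrees
open LocalizationGame

cops-at-most-v/k : ∀ t k → 2 ≤ t → t < k → ∃[ v₀ ] ∀ (v b : ℕ) (B : Fin b → Subset v) → v₀ ≤ v →
  IsSteiner t k v b B → ∃[ m ] (CopsWin (IncAdj B) m × k * m ≤ v)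
-- The second summand of the threshold forces ⌊v/k⌋ ≥ 2 k (k + 2) and hence `c₀` ≥ k + 2, which
-- leaves room for k² further probes and for all rounding.
cops-at-most-v/k t k@(suc j) 2≤t t<k = v₀ + k * (2 * k * (k + 2)) , win
  where
  open Constants k
  win : ∀ v b B → v₀ + k * (2 * k * (k + 2)) ≤ v → IsSteiner t k v b B → ∃[ m ] (CopsWin (IncAdj B) m × k * m ≤ v)
  win v b B large steiner = m , Game.cops-win steiner blocks u count cover i<m n+kk≤m , ≤-trans (≤-reflexive (*-comm k m)) (m/n*n≤m v k)
    where
    open ≤-Reasoning
    -- Choosing `c` blocks fewer than `m` leaves v mod k + k c points uncovered. Rounding m / 2k up
    -- to `c` secures `active`, while k `c₀` ≤ m / 2 leaves half of the probes for the remaining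
    -- terms of `n+kk≤m`. As `c` is positive, one cop is free to sweep.
    m c₀ c i w : ℕ
    m  = v / k
    c₀ = m / (2 * k)
    c  = suc c₀
    i  = m ∸ c
    w  = v % k + k * c ∸ k * k
    m-large : 2 * k * (k + 2) ≤ m
    m-large = begin
      2 * k * (k + 2)               ≡⟨ m*n/n≡m (2 * k * (k + 2)) k ⟨
      2 * k * (k + 2) * k / k       ≤⟨ /-monoˡ-≤ k (≤-trans (≤-reflexive (*-comm (2 * k * (k + 2)) k)) (≤-trans (m≤n+m _ v₀) large)) ⟩
      v / k                         ∎
    k+2≤c₀ : k + 2 ≤ c₀
    k+2≤c₀ = begin
      k + 2                         ≡⟨ m*n/n≡m (k + 2) (2 * k) ⟨
      (k + 2) * (2 * k) / (2 * k)   ≤⟨ /-monoˡ-≤ (2 * k) (≤-trans (≤-reflexive (*-comm (k + 2) (2 * k))) m-large) ⟩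
      c₀                            ∎
    2kc₀≤m : c₀ * (2 * k) ≤ m
    2kc₀≤m = m/n*n≤m m (2 * k)
    m<2kc : m ≤ 2 * k * c
    m<2kc = begin
      m                                  ≡⟨ m≡m%n+[m/n]*n m (2 * k) ⟩
      m % (2 * k) + c₀ * (2 * k)         ≤⟨ +-monoˡ-≤ (c₀ * (2 * k)) (<⇒≤ (m%n<n m (2 * k))) ⟩
      2 * k + c₀ * (2 * k)               ≡⟨ *-comm c (2 * k) ⟩
      2 * k * c                          ∎
    kk≤n : k * k ≤ v % k + k * c
    kk≤n = ≤-trans (*-monoʳ-≤ k (≤-trans (m≤m+n k 2) (≤-trans k+2≤c₀ (n≤1+n c₀)))) (m≤n+m (k * c) (v % k))
    n≡ : k * k + w ≡ v % k + k * c
    n≡ = m+[n∸m]≡n kk≤n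
    c≤m : c ≤ m
    c≤m = begin
      suc c₀              ≤⟨ +-monoˡ-≤ c₀ (≤-trans (s≤s z≤n) k+2≤c₀) ⟩
      c₀ + c₀             ≡⟨ alg₁ c₀ ⟩
      c₀ * (2 * 1)        ≤⟨ *-monoʳ-≤ c₀ (*-monoʳ-≤ 2 (s≤s {n = j} z≤n)) ⟩
      c₀ * (2 * k)        ≤⟨ 2kc₀≤m ⟩
      m                   ∎
      where
      alg₁ : ∀ c → c + c ≡ c * 2
      alg₁ = solve-∀
    v-split : v ≡ k * k + k * i + w
    v-split = begin-equality
      v                              ≡⟨ m≡m%n+[m/n]*n v k ⟩
      v % k + m * k                  ≡⟨ cong (λ z → v % k + z * k) (m∸n+n≡m c≤m) ⟨
      v % k + (i + c) * k            ≡⟨ alg₁ (v % k) i c k ⟩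
      v % k + k * c + k * i          ≡⟨ cong (_+ k * i) n≡ ⟨
      k * k + w + k * i              ≡⟨ alg₂ (k * k) w (k * i) ⟩
      k * k + k * i + w              ∎
      where
      alg₁ : ∀ r i c k → r + (i + c) * k ≡ r + k * c + k * i
      alg₁ = solve-∀
      alg₂ : ∀ a w c → a + w + c ≡ a + c + w
      alg₂ = solve-∀
    active : v ≤ 2 * k * (k * k + w)
    active = begin
      v                              ≡⟨ m≡m%n+[m/n]*n v k ⟩
      v % k + m * k                  ≤⟨ +-mono-≤ (m≤n*m (v % k) (2 * k)) (*-monoˡ-≤ k m<2kc) ⟩
      2 * k * (v % k) + 2 * k * c * k ≡⟨ alg₁ k (v % k) c ⟩
      2 * k * (v % k + k * c)        ≡⟨ cong (2 * k *_) n≡ ⟨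
      2 * k * (k * k + w)            ∎
      where
      alg₁ : ∀ k r c → 2 * k * r + 2 * k * c * k ≡ 2 * k * (r + k * c)
      alg₁ = solve-∀
    i<m : suc i ≤ m
    i<m = begin
      suc (m ∸ suc c₀)     ≡⟨ +-∸-assoc 1 c≤m ⟨
      m ∸ c₀               ≤⟨ m∸n≤m m c₀ ⟩
      m                    ∎
    n+kk≤m : k * k + w + k * k ≤ m
    n+kk≤m = begin
      k * k + w + k * k              ≡⟨ cong (_+ k * k) n≡ ⟩
      v % k + k * c + k * k          ≤⟨ +-monoˡ-≤ (k * k) (+-monoˡ-≤ (k * c) (<⇒≤ (m%n<n v k))) ⟩
      k + k * c + k * k              ≡⟨ alg₁ k c₀ ⟩
      k * (k + 2) + k * c₀           ≤⟨ +-monoˡ-≤ (k * c₀) (*-monoʳ-≤ k k+2≤c₀) ⟩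
      k * c₀ + k * c₀                ≡⟨ alg₂ k c₀ ⟩
      c₀ * (2 * k)                   ≤⟨ 2kc₀≤m ⟩
      m                              ∎
      where
      alg₁ : ∀ k c → k + k * (1 + c) + k * k ≡ k * (k + 2) + k * c
      alg₁ = solve-∀
      alg₂ : ∀ k c → k * c + k * c ≡ c * (2 * k)
      alg₂ = solve-∀
    v≡ : v ≡ k * k + (k * i + w)
    v≡ = trans v-split (+-assoc (k * k) (k * i) w)
    open Design steiner using (inc; D; l; 1≤D; regular; lv≤kD)
    open Process j (≤-trans (s≤s z≤n) (≤-pred (≤-trans (s≤s 2≤t) t<k))) inc D l 1≤D regular lv≤kD (k * i + w) v≡ using (State; states)
    open State (states (≤-trans (m≤m+n v₀ _) large) i w v-split active) using (blocks; u; count; cover)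

0^ : ∀ n .{{_ : NonZero n}} → 0 ^ n ≡ 0
0^ (suc n) = refl

-- Truncated subtraction makes the base zero, and k > 1 makes the exponent positive.
excess-vanishes : ∀ {k m v} → 1 < k → k * m ≤ v → (k * m ∸ v) ^ (k ∸ 1) ≡ 0
excess-vanishes {k} 1<k km≤v = trans (cong (_^ (k ∸ 1)) (m≤n⇒m∸n≡0 km≤v)) (0^ (k ∸ 1) {{>-nonZero (∸-monoˡ-≤ 1 1<k)}})

theorem4p5 : (∀ (k : ℕ) → 2 < k →
    ∃[ C ] ∃[ v₀ ] ∀ (v b : ℕ) (B : Fin b → Subset v) → v₀ ≤ v →
    IsSteiner 2 k v b B →
    LocNumSatisfies (IncAdj B) (Bound2 k C v))
    ×
    (∀ (t k : ℕ) → 2 ≤ t → t < k →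
    ∃[ C ] ∃[ v₀ ] ∀ (v b : ℕ) (B : Fin b → Subset v) → v₀ ≤ v →
    IsSteiner t k v b B →
    LocNumSatisfies (IncAdj B) (BoundT t k C v))
theorem4p5 = part₂ , partₜ
  where
  part₂ : ∀ (k : ℕ) → 2 < k → ∃[ C ] ∃[ v₀ ] ∀ (v b : ℕ) (B : Fin b → Subset v) → v₀ ≤ v →
    IsSteiner 2 k v b B → LocNumSatisfies (IncAdj B) (Bound2 k C v)
  part₂ k 2<k with cops-at-most-v/k 2 k ≤-refl 2<k
  ... | v₀ , win = 0 , v₀ , λ v b B v₀≤v steiner → bounded v (win v b B v₀≤v steiner)
    where
    bounded : ∀ v {b} {B : Fin b → Subset v} → ∃[ m ] (CopsWin (IncAdj B) m × k * m ≤ v) → LocNumSatisfies (IncAdj B) (Bound2 k 0 v)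
    bounded v (m , wins , km≤v) = m , wins , ≤-trans (≤-reflexive (excess-vanishes {k} {m} {v} (<-trans (n<1+n 1) 2<k) km≤v)) z≤n
  partₜ : ∀ (t k : ℕ) → 2 ≤ t → t < k → ∃[ C ] ∃[ v₀ ] ∀ (v b : ℕ) (B : Fin b → Subset v) → v₀ ≤ v →
    IsSteiner t k v b B → LocNumSatisfies (IncAdj B) (BoundT t k C v)
  partₜ t k 2≤t t<k with cops-at-most-v/k t k 2≤t t<k
  ... | v₀ , win = 0 , v₀ , λ v b B v₀≤v steiner → bounded v (win v b B v₀≤v steiner)
    where
    open import Data.Nat.Combinatorics using (_C_)
    bounded : ∀ v {b} {B : Fin b → Subset v} → ∃[ m ] (CopsWin (IncAdj B) m × k * m ≤ v) → LocNumSatisfies (IncAdj B) (BoundT t k 0 v)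
    bounded v (m , wins , km≤v) = m , wins ,
      ≤-trans (≤-reflexive (cong (_* ((v ∸ 1) C (t ∸ 1))) (excess-vanishes {k} {m} {v} (≤-<-trans (≤-trans (n≤1+n 1) 2≤t) t<k) km≤v))) z≤n
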